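{- Let $G$ be a graph with $\alpha(G)\ge 2$. If $G$ has no induced subgraph isomorphic to $C_k$ for any $k$ with $4\le k\le 2\alpha(G)$, then $oh(G)\ge \chi(G)$.
   Context: All graphs are finite, without loops or parallel edges. $C_k$ is the cycle on $k$ vertices; $\alpha(G)$ is the independence number and $\chi(G)$ the chromatic number of $G$. A graph $G$ has an odd clique minor of size at least $k$ if there are $k$ vertex-disjoint trees in $G$ such that every two of them are joined by an edge of $G$, and all vertices of the trees can be two-colored so that edges within each tree are bichromatic while the edges between trees are monochromatic (hence all trivial, one-vertex, trees receive the same color). The odd Hadwiger number $oh(G)$ is the largest $k$ such that $G$ has an odd clique minor of size $k$. -}

module Defs where

open import Data.Nat using (ℕ; zero; suc; _+_; _*_; _≤_; _<_)
open import Data.Fin using (Fin; toℕ)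
open import Data.Fin.Subset using (Subset; _∈_; ∣_∣)
open import Data.Bool using (Bool; true; false)
open import Data.Maybe using (Maybe; just)
open import Data.Product using (Σ; ∃; ∃₂; _×_)
open import Data.Sum using (_⊎_)
open import Relation.Binary.PropositionalEquality using (_≡_; _≢_)
open import Function.Definitions using (Injective)

record Graph (n : ℕ) : Set where
  field
    adj     : Fin n → Fin n → Bool
    adj-sym : ∀ u v → adj u v ≡ adj v u
    irrefl  : ∀ v → adj v v ≡ false
open Graph public

module _ {n : ℕ} (G : Graph n) where

  Independent : Subset n → Set
  Independent S = ∀ u v → u ∈ S → v ∈ S → adj G u v ≡ false

  IsIndependenceNumber : ℕ → Set
  IsIndependenceNumber a =
    (Σ (Subset n) λ S → Independent S × ∣ S ∣ ≡ a) ×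
    (∀ S → Independent S → ∣ S ∣ ≤ a)

  ProperColouring : (k : ℕ) → (Fin n → Fin k) → Set
  ProperColouring k c = ∀ u v → adj G u v ≡ true → c u ≢ c v

  Colourable : ℕ → Set
  Colourable k = Σ (Fin n → Fin k) (ProperColouring k)

  IsChromaticNumber : ℕ → Set
  IsChromaticNumber c = Colourable c × (∀ k → Colourable k → c ≤ k)

  CycAdj : (k : ℕ) → Fin k → Fin k → Set
  CycAdj k i j =
    (suc (toℕ i) ≡ toℕ j) ⊎ (suc (toℕ j) ≡ toℕ i) ⊎
    (suc (toℕ i) ≡ k × toℕ j ≡ 0) ⊎ (suc (toℕ j) ≡ k × toℕ i ≡ 0)

  HasInducedCycle : ℕ → Set
  HasInducedCycle k = Σ (Fin k → Fin n) λ f → Injective _≡_ _≡_ f ×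
    (∀ i j → (adj G (f i) (f j) ≡ true → CycAdj k i j) ×
             (CycAdj k i j → adj G (f i) (f j) ≡ true))

  -- An odd clique minor of size k: k vertex-disjoint trees T_i
  -- (vertex v lies in T_i iff branch v ≡ just i; T_i is given as a rooted
  -- tree via root / parent pointers with strictly decreasing depth),
  -- a 2-colouring such that tree edges are bichromatic, and for every two
  -- distinct trees a monochromatic edge of G joining them.
  record OddCliqueMinor (k : ℕ) : Set where
    field
      branch  : Fin n → Maybe (Fin k)
      root    : Fin k → Fin n
      root-in : ∀ i → branch (root i) ≡ just i
      parent  : Fin n → Fin n
      depth   : Fin n → ℕ
      parent-ok : ∀ v i → branch v ≡ just i → v ≢ root i →
        branch (parent v) ≡ just i × adj G v (parent v) ≡ true ×
        depth (parent v) < depth v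
      colour  : Fin n → Bool
      tree-bichromatic : ∀ v i → branch v ≡ just i → v ≢ root i →
        colour v ≢ colour (parent v)
      joined  : ∀ i j → i ≢ j → ∃₂ λ u v →
        branch u ≡ just i × branch v ≡ just j ×
        adj G u v ≡ true × colour u ≡ colour v

  IsOddHadwigerNumber : ℕ → Set
  IsOddHadwigerNumber h = OddCliqueMinor h × (∀ k → OddCliqueMinor k → k ≤ h)

{-# OPTIONS --safe #-}
module Submission where

-- A hole of length at least 2α + 2 contains α + 1 independent vertices, so all holes of G have
-- length 2α + 1.  If there is none, G is chordal and contains a clique of size χ(G).  Otherwise fix
-- such a cycle.  Short holes and large independent sets are excluded, so every vertex either
-- dominates the cycle or is close (equal or adjacent) to exactly three consecutive vertices of it.
-- Thus G is a clique J joined to an inflation of C₂α₊₁ with cliques A₀, ..., A₂α.  Let ω be the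
-- maximum of |Aᵢ| + |Aᵢ₊₁| and s the minimum of |Aᵢ|.  Deleting a smallest Aᵢ leaves a path of
-- cliques, which is coloured with ω colours from below and from above alternately, so
-- χ(G) ≤ |J| + ω + s.  Conversely, J together with a largest Aᵢ ∪ Aᵢ₊₁ and s disjoint paths through
-- the other 2α - 1 cliques is an odd clique minor of that size: the paths have an odd number of
-- vertices, so both ends can receive the colour of the one-vertex trees.

open import Data.Bool using (Bool; true; false; _∨_; _∧_; not)
import Data.Bool.Properties as Bool
open import Data.Empty using (⊥; ⊥-elim)
open import Data.Fin as Fin using (Fin; zero; suc; toℕ)
import Data.Fin.Properties as Fin
open import Data.Fin.Subset using (Subset; _∈_; ∣_∣; _-_)
open import Data.Fin.Subset.Properties using (x∈p⇒∣p-x∣<∣p∣; x∈p∧x≢y⇒x∈p-y)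
open import Data.List using (List; []; _∷_; length; lookup; filter; allFin)
open import Data.List.Membership.Propositional.Properties using (∈-filter⁺; ∈-filter⁻; ∈-allFin; ∈-lookup)
open import Data.List.Relation.Unary.All as All using (All; []; _∷_)
open import Data.List.Relation.Unary.AllPairs using ([]; _∷_)
import Data.List.Relation.Unary.Any as Any
open import Data.List.Relation.Unary.Any.Properties using (lookup-index)
open import Data.List.Relation.Unary.Unique.Propositional using (Unique)
open import Data.List.Relation.Unary.Unique.Propositional.Properties using (allFin⁺; filter⁺)
open import Data.Maybe as Maybe using (Maybe; just; nothing; maybe)
open import Data.Nat using (ℕ; zero; suc; _+_; _*_; _≤_; _<_; z≤n; s≤s; pred; _∸_)
open import Data.Nat.DivMod using (_%_; _/_; m≡m%n+[m/n]*n; m%n<n; _mod_; m<n⇒m%n≡m; [m+n]%n≡m%n)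
import Data.Nat.Properties as ℕ
open import Data.Product using (∃; Σ; _×_; _,_; proj₁; proj₂; ∃₂)
open import Data.Sum using (_⊎_; inj₁; inj₂)
open import Data.Vec using (tabulate)
open import Data.Vec.Properties using ([]=⇒lookup; lookup⇒[]=; lookup∘tabulate)
open import Defs
open import Function using (_∘_; case_of_)
open import Function.Definitions using (Injective)
import Relation.Binary.Construct.Flip.EqAndOrd as Flip
open import Relation.Binary.Definitions using (tri<; tri≈; tri>)
open import Relation.Binary.PropositionalEquality using (_≡_; _≢_; refl; sym; trans; cong; cong₂; subst; subst₂; ≢-sym)
open import Relation.Binary.Structures using (IsTotalPreorder)
open import Relation.Nullary using (¬_; Dec; yes; no; does)
open import Relation.Nullary.Decidable using (dec-true; dec-false; _×-dec_; _→-dec_; decidable-stable)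

-- Booleans and sizes of vertex sets

true-or-false : (b : Bool) → b ≡ true ⊎ b ≡ false
true-or-false true  = inj₁ refl
true-or-false false = inj₂ refl

true≢false : {b : Bool} → b ≡ true → b ≡ false → ⊥
true≢false refl ()

¬false⇒true : {b : Bool} → (b ≡ false → ⊥) → b ≡ true
¬false⇒true {true}  _ = refl
¬false⇒true {false} f = ⊥-elim (f refl)

¬true⇒false : {b : Bool} → (b ≡ true → ⊥) → b ≡ false
¬true⇒false {false} _ = refl
¬true⇒false {true}  f = ⊥-elim (f refl)

lookup-injective : {A : Set} {xs : List A} → Unique xs → Injective _≡_ _≡_ (lookup xs)
lookup-injective (_ ∷ _) {zero} {zero} _ = refl
lookup-injective (x∉xs ∷ _) {zero} {suc j} eq = ⊥-elim (All.lookup x∉xs (∈-lookup j) eq)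
lookup-injective (x∉xs ∷ _) {suc i} {zero} eq = ⊥-elim (All.lookup x∉xs (∈-lookup i) (sym eq))
lookup-injective (_ ∷ u) {suc i} {suc j} eq = cong suc (lookup-injective u eq)

module _ {n : ℕ} (p : Fin n → Bool) where

  abstract
    elements : List (Fin n)
    elements = filter (λ v → p v Bool.≟ true) (allFin n)

    size : ℕ
    size = length elements

    element : Fin size → Fin n
    element = lookup elements

    element-∈ : ∀ j → p (element j) ≡ true
    element-∈ j = proj₂ (∈-filter⁻ (λ v → p v Bool.≟ true) {xs = allFin n} (∈-lookup j))

    element-injective : Injective _≡_ _≡_ element
    element-injective = lookup-injective (filter⁺ (λ v → p v Bool.≟ true) (allFin⁺ n))

    rank : ∀ v → p v ≡ true → Fin size
    rank v v∈p = Any.index (∈-filter⁺ (λ w → p w Bool.≟ true) (∈-allFin v) v∈p)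

    element-rank : ∀ v (v∈p : p v ≡ true) → element (rank v v∈p) ≡ v
    element-rank v v∈p = sym (lookup-index (∈-filter⁺ (λ w → p w Bool.≟ true) (∈-allFin v) v∈p))

  rank-injective : ∀ {v w} (v∈p : p v ≡ true) (w∈p : p w ≡ true) → rank v v∈p ≡ rank w w∈p → v ≡ w
  rank-injective v∈p w∈p eq =
    trans (sym (element-rank _ v∈p)) (trans (cong element eq) (element-rank _ w∈p))

  injection⇒≤size : ∀ {m} {f : Fin m → Fin n} → Injective _≡_ _≡_ f → (∀ i → p (f i) ≡ true) → m ≤ size
  injection⇒≤size {f = f} inj f∈p =
    Fin.injective⇒≤ {f = λ i → rank (f i) (f∈p i)} (inj ∘ rank-injective (f∈p _) (f∈p _))

size-mono : ∀ {n} {p q : Fin n → Bool} → (∀ v → p v ≡ true → q v ≡ true) → size p ≤ size q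
size-mono {p = p} {q} p⊆q =
  injection⇒≤size q (element-injective p) (λ i → p⊆q _ (element-∈ p i))

-- The enumeration of `p` with `v` put in front is an injection into `q`.
size-strict : ∀ {n} {p q : Fin n → Bool} → (∀ v → p v ≡ true → q v ≡ true) →
  ∀ v → q v ≡ true → p v ≡ false → size p < size q
size-strict {n} {p} {q} p⊆q v v∈q v∉p = injection⇒≤size q f-injective f∈q
  where
  f : Fin (suc (size p)) → Fin n
  f zero    = v
  f (suc i) = element p i
  v≢element : ∀ i → v ≢ element p i
  v≢element i eq = true≢false (element-∈ p i) (subst (λ w → p w ≡ false) eq v∉p)
  f-injective : Injective _≡_ _≡_ f
  f-injective {zero}  {zero}  _  = refl
  f-injective {zero}  {suc j} eq = ⊥-elim (v≢element j eq)
  f-injective {suc i} {zero}  eq = ⊥-elim (v≢element i (sym eq))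
  f-injective {suc i} {suc j} eq = cong suc (element-injective p eq)
  f∈q : ∀ i → q (f i) ≡ true
  f∈q zero    = v∈q
  f∈q (suc i) = p⊆q _ (element-∈ p i)

splitAt-injective : ∀ m {n} {i j : Fin (m + n)} → Fin.splitAt m i ≡ Fin.splitAt m j → i ≡ j
splitAt-injective m {n} {i} {j} eq = trans (sym (Fin.join-splitAt m n i))
  (trans (cong (Fin.join m n) eq) (Fin.join-splitAt m n j))

size-∨ : ∀ {n} (p q : Fin n → Bool) → (∀ v → p v ≡ true → q v ≡ true → ⊥) →
  size p + size q ≤ size (λ v → p v ∨ q v)
size-∨ {n} p q disjoint = injection⇒≤size _ {f = f ∘ Fin.splitAt (size p)}
  (splitAt-injective (size p) ∘ f-injective _ _)
  (f∈ ∘ Fin.splitAt (size p))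
  where
  f : Fin (size p) ⊎ Fin (size q) → Fin n
  f (inj₁ i) = element p i
  f (inj₂ i) = element q i
  f-injective : ∀ x y → f x ≡ f y → x ≡ y
  f-injective (inj₁ i) (inj₁ j) eq = cong inj₁ (element-injective p eq)
  f-injective (inj₁ i) (inj₂ j) eq =
    ⊥-elim (disjoint _ (element-∈ p i) (subst (λ v → q v ≡ true) (sym eq) (element-∈ q j)))
  f-injective (inj₂ i) (inj₁ j) eq =
    ⊥-elim (disjoint _ (element-∈ p j) (subst (λ v → q v ≡ true) eq (element-∈ q i)))
  f-injective (inj₂ i) (inj₂ j) eq = cong inj₂ (element-injective q eq)
  f∈ : ∀ x → (p (f x) ∨ q (f x)) ≡ true
  f∈ (inj₁ i) rewrite element-∈ p i = refl
  f∈ (inj₂ i) rewrite element-∈ q i = Bool.∨-zeroʳ _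

injection⇒≤∣∣ : ∀ {n} m (f : Fin m → Fin n) → Injective _≡_ _≡_ f →
  (S : Subset n) → (∀ i → f i ∈ S) → m ≤ ∣ S ∣
injection⇒≤∣∣ zero    f inj S f∈S = z≤n
injection⇒≤∣∣ (suc m) f inj S f∈S = ℕ.≤-trans
  (s≤s (injection⇒≤∣∣ m (f ∘ suc) (Fin.suc-injective ∘ inj) (S - f zero)
    (λ i → x∈p∧x≢y⇒x∈p-y (f∈S (suc i)) (λ eq → Fin.0≢1+n (sym (inj eq))))))
  (x∈p⇒∣p-x∣<∣p∣ (f∈S zero))

-- Closeness, independent sets and holes

module _ {n : ℕ} (G : Graph n) where

  -- Working with the reflexive closure of adjacency spares all distinctness side conditions:
  -- in an induced cycle they follow from the pattern of close and far pairs.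
  abstract
    close : Fin n → Fin n → Bool
    close u v = does (u Fin.≟ v) ∨ adj G u v

    close-refl : ∀ v → close v v ≡ true
    close-refl v rewrite dec-true (v Fin.≟ v) refl = refl

    close-sym : ∀ u v → close u v ≡ close v u
    close-sym u v with u Fin.≟ v
    ... | yes refl = sym (close-refl v)
    ... | no u≢v rewrite dec-false (v Fin.≟ u) (u≢v ∘ sym) = adj-sym G u v

    adj⇒Close : ∀ {u v} → adj G u v ≡ true → close u v ≡ true
    adj⇒Close {u} {v} eq rewrite eq = Bool.∨-zeroʳ _

    Close∧≢⇒adj : ∀ {u v} → close u v ≡ true → u ≢ v → adj G u v ≡ true
    Close∧≢⇒adj {u} {v} uv u≢v rewrite dec-false (u Fin.≟ v) u≢v = uv

  Close Far : Fin n → Fin n → Set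
  Close u v = close u v ≡ true
  Far u v = close u v ≡ false

  Close-sym : ∀ {u v} → Close u v → Close v u
  Close-sym {u} {v} = trans (close-sym v u)

  Far-sym : ∀ {u v} → Far u v → Far v u
  Far-sym {u} {v} = trans (close-sym v u)

  adj⇒≢ : ∀ {u v} → adj G u v ≡ true → u ≢ v
  adj⇒≢ {u} eq refl = true≢false eq (irrefl G u)

  Far⇒≢ : ∀ {u v} → Far u v → u ≢ v
  Far⇒≢ {u} uv refl = true≢false (close-refl u) uv

  Far⇒¬adj : ∀ {u v} → Far u v → adj G u v ≡ true → ⊥
  Far⇒¬adj uv eq = true≢false (adj⇒Close eq) uv

  ≢∧¬adj⇒Far : ∀ {u v} → u ≢ v → (adj G u v ≡ true → ⊥) → Far u v
  ≢∧¬adj⇒Far u≢v ¬adj = ¬true⇒false (λ uv → ¬adj (Close∧≢⇒adj uv u≢v))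

  Close∧Far⇒≢ : ∀ {u v w} → Close u w → Far v w → u ≢ v
  Close∧Far⇒≢ uw vw refl = true≢false uw vw

  -- The upper bound on independent sets is only ever used in this form. Indexing by natural numbers
  -- lets the callers describe the `a + 1` vertices by plain arithmetic.
  independent-bound : ∀ {a} → IsIndependenceNumber G a → (x : ℕ → Fin n) →
    (∀ i j → i < j → j ≤ a → Far (x i) (x j)) → ⊥
  independent-bound {a} (_ , maximal) x far =
    ℕ.1+n≰n (ℕ.≤-trans (injection⇒≤∣∣ (suc a) f f-injective S f∈S) (maximal S independent))
    where
    f : Fin (suc a) → Fin n
    f i = x (toℕ i)
    f-far : ∀ i j → i Fin.< j → Far (f i) (f j)
    f-far i j i<j = far _ _ i<j (ℕ.≤-pred (Fin.toℕ<n j))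
    f-injective : Injective _≡_ _≡_ f
    f-injective {i} {j} eq with Fin.<-cmp i j
    ... | tri< i<j _ _ = ⊥-elim (Far⇒≢ (f-far i j i<j) eq)
    ... | tri≈ _ i≡j _ = i≡j
    ... | tri> _ _ j<i = ⊥-elim (Far⇒≢ (f-far j i j<i) (sym eq))
    image? : ∀ v → Dec (∃ λ i → f i ≡ v)
    image? v = Fin.any? (λ i → f i Fin.≟ v)
    S : Subset n
    S = tabulate (λ v → does (image? v))
    f∈S : ∀ i → f i ∈ S
    f∈S i = lookup⇒[]= (f i) S (trans (lookup∘tabulate _ (f i)) (dec-true (image? (f i)) (i , refl)))
    S⊆f : ∀ {v} → v ∈ S → ∃ λ i → f i ≡ v
    S⊆f {v} v∈S = case image? v of λ where
      (yes i) → i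
      (no ¬i) → ⊥-elim (true≢false
        (trans (sym (lookup∘tabulate (does ∘ image?) v)) ([]=⇒lookup v∈S)) (dec-false (image? v) ¬i))
    independent : Independent G S
    independent u v u∈S v∈S with S⊆f u∈S | S⊆f v∈S
    ... | i , refl | j , refl with Fin.<-cmp i j
    ... | tri< i<j _ _  = ¬true⇒false (Far⇒¬adj (f-far i j i<j))
    ... | tri≈ _ refl _ = irrefl G (f i)
    ... | tri> _ _ j<i  = trans (adj-sym G (f i) (f j)) (¬true⇒false (Far⇒¬adj (f-far j i j<i)))

  -- An induced path x ∷ p ending at y, where y is the only vertex close to r.
  data Arc (r y : Fin n) : Fin n → List (Fin n) → Set where
    end  : Close r y → Arc r y y []
    step : ∀ {x z p} → Far r x → Close x z → All (Far x) p → Arc r y z p → Arc r y x (z ∷ p)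

  -- The index is the length of the cycle r, x, z, q, ...
  data Hole : ℕ → Set where
    hole : ∀ {r y x z q p} → Close r x → Close x z → All (Far x) (q ∷ p) →
      Arc r y z (q ∷ p) → Hole (4 + length p)

  -- In a hole the vertex after the apex `r` is close to `r` and so cannot start an `Arc`.
  -- Forgetting the apex allows it to be put in front of the path.
  data InducedPath : Fin n → List (Fin n) → Set where
    end  : ∀ {x} → InducedPath x []
    step : ∀ {x z p} → adj G x z ≡ true → All (Far x) p → InducedPath z p → InducedPath x (z ∷ p)

  Arc⇒InducedPath : ∀ {r y x p} → Arc r y x p → InducedPath x p
  Arc⇒InducedPath (end _) = end
  Arc⇒InducedPath (step rx xz xp arc) =
    step (Close∧≢⇒adj xz (x≢z rx xp arc)) xp (Arc⇒InducedPath arc)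
    where
    -- `Close` alone would allow `x` to equal `z`. They are told apart by `r` if `z` ends the arc,
    -- and by the vertex after `z` otherwise.
    x≢z : ∀ {r y x z p} → Far r x → All (Far x) p → Arc r y z p → x ≢ z
    x≢z rx _ (end ry) = ≢-sym (Close∧Far⇒≢ (Close-sym ry) (Far-sym rx))
    x≢z _ (xq ∷ _) (step _ zq _ _) = ≢-sym (Close∧Far⇒≢ zq xq)

  path-pairs : ∀ {x p} → InducedPath x p → ∀ i j → i Fin.< j →
    let f = lookup (x ∷ p) in
    (suc (toℕ i) ≡ toℕ j × adj G (f i) (f j) ≡ true) ⊎ (suc (toℕ i) ≢ toℕ j × Far (f i) (f j))
  path-pairs (step xz _ _) zero (suc zero) _ = inj₁ (refl , xz)
  path-pairs (step _ xp _) zero (suc (suc j)) _ = inj₂ ((λ ()) , All.lookup xp (∈-lookup j))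
  path-pairs (step _ _ path) (suc i) (suc j) (s≤s i<j) with path-pairs path i j i<j
  ... | inj₁ (eq , e) = inj₁ (cong suc eq , e)
  ... | inj₂ (neq , f) = inj₂ (neq ∘ ℕ.suc-injective , f)

  apex-pairs : ∀ {r y x p} → Arc r y x p → ∀ j →
    let f = lookup (x ∷ p) in
    (toℕ j ≡ length p × Close r (f j)) ⊎ (toℕ j ≢ length p × Far r (f j))
  apex-pairs (end ry) zero = inj₁ (refl , ry)
  apex-pairs (step rx _ _ _) zero = inj₂ ((λ ()) , rx)
  apex-pairs (step _ _ _ arc) (suc j) with apex-pairs arc j
  ... | inj₁ (eq , e) = inj₁ (cong suc eq , e)
  ... | inj₂ (neq , f) = inj₂ (neq ∘ ℕ.suc-injective , f)

  CycAdj-sym : ∀ k {i j} → CycAdj G k i j → CycAdj G k j i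
  CycAdj-sym k (inj₁ e) = inj₂ (inj₁ e)
  CycAdj-sym k (inj₂ (inj₁ e)) = inj₁ e
  CycAdj-sym k (inj₂ (inj₂ (inj₁ e))) = inj₂ (inj₂ (inj₂ e))
  CycAdj-sym k (inj₂ (inj₂ (inj₂ e))) = inj₂ (inj₂ (inj₁ e))

  CycAdj-irrefl : ∀ {k} → 2 ≤ k → ∀ i → CycAdj G k i i → ⊥
  CycAdj-irrefl _ i (inj₁ e) = ℕ.1+n≢n e
  CycAdj-irrefl _ i (inj₂ (inj₁ e)) = ℕ.1+n≢n e
  CycAdj-irrefl {k} 2≤k i (inj₂ (inj₂ e)) = bad e
    where
    bad : (suc (toℕ i) ≡ k × toℕ i ≡ 0) ⊎ (suc (toℕ i) ≡ k × toℕ i ≡ 0) → ⊥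
    bad (inj₁ (e , z)) = ℕ.<⇒≢ 2≤k (trans (cong suc (sym z)) e)
    bad (inj₂ (e , z)) = ℕ.<⇒≢ 2≤k (trans (cong suc (sym z)) e)

  -- Both alternatives exclude `f i ≡ f j`, so injectivity comes for free, and symmetry reduces
  -- everything to `i < j`.
  pairs⇒induced-cycle : ∀ {k} → 2 ≤ k → (f : Fin k → Fin n) →
    (∀ i j → i Fin.< j →
      (CycAdj G k i j × adj G (f i) (f j) ≡ true) ⊎ (¬ CycAdj G k i j × Far (f i) (f j))) →
    HasInducedCycle G k
  pairs⇒induced-cycle {k} 2≤k f pairs = f , injective , λ i j → edge i j , cyc i j
    where
    injective : Injective _≡_ _≡_ f
    injective {i} {j} eq with Fin.<-cmp i j
    ... | tri≈ _ i≡j _ = i≡j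
    ... | tri< i<j _ _ = case pairs i j i<j of λ where
      (inj₁ (_ , e)) → ⊥-elim (adj⇒≢ e eq)
      (inj₂ (_ , e)) → ⊥-elim (Far⇒≢ e eq)
    ... | tri> _ _ j<i = case pairs j i j<i of λ where
      (inj₁ (_ , e)) → ⊥-elim (adj⇒≢ e (sym eq))
      (inj₂ (_ , e)) → ⊥-elim (Far⇒≢ e (sym eq))
    edge : ∀ i j → adj G (f i) (f j) ≡ true → CycAdj G k i j
    edge i j e with Fin.<-cmp i j
    ... | tri≈ _ refl _ = ⊥-elim (true≢false e (irrefl G (f i)))
    ... | tri< i<j _ _ = case pairs i j i<j of λ where
      (inj₁ (c , _)) → c
      (inj₂ (_ , far)) → ⊥-elim (Far⇒¬adj far e)
    ... | tri> _ _ j<i = case pairs j i j<i of λ where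
      (inj₁ (c , _)) → CycAdj-sym k c
      (inj₂ (_ , far)) → ⊥-elim (Far⇒¬adj far (trans (adj-sym G (f j) (f i)) e))
    cyc : ∀ i j → CycAdj G k i j → adj G (f i) (f j) ≡ true
    cyc i j c with Fin.<-cmp i j
    ... | tri≈ _ refl _ = ⊥-elim (CycAdj-irrefl 2≤k i c)
    ... | tri< i<j _ _ = case pairs i j i<j of λ where
      (inj₁ (_ , e)) → e
      (inj₂ (¬c , _)) → ⊥-elim (¬c c)
    ... | tri> _ _ j<i = case pairs j i j<i of λ where
      (inj₁ (_ , e)) → trans (adj-sym G (f i) (f j)) e
      (inj₂ (¬c , _)) → ⊥-elim (¬c (CycAdj-sym k c))

  Hole⇒HasInducedCycle : ∀ {k} → Hole k → HasInducedCycle G k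
  Hole⇒HasInducedCycle (hole {r} {y} {x} {z} {q} {p} rx xz xp@(xq ∷ _) arc@(step rz zq _ _)) =
    pairs⇒induced-cycle (s≤s (s≤s z≤n)) f pairs
    where
    f : Fin (4 + length p) → Fin n
    f = lookup (r ∷ x ∷ z ∷ q ∷ p)
    path : InducedPath x (z ∷ q ∷ p)
    path = step (Close∧≢⇒adj xz (≢-sym (Close∧Far⇒≢ zq xq))) xp (Arc⇒InducedPath arc)
    pairs : ∀ i j → i Fin.< j →
      (CycAdj G _ i j × adj G (f i) (f j) ≡ true) ⊎ (¬ CycAdj G _ i j × Far (f i) (f j))
    pairs zero (suc zero) _ =
      inj₁ (inj₁ refl , Close∧≢⇒adj rx (≢-sym (Close∧Far⇒≢ xz rz)))
    pairs zero (suc (suc j)) _ with apex-pairs arc j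
    -- The one vertex of the arc close to `r` is its last, which gives the closing edge of the
    -- cycle. It differs from `r` because `x` is close to `r` and far from everything after `z`.
    ... | inj₁ (eq , rj) = inj₁ (inj₂ (inj₂ (inj₂ (cong (3 +_) eq , refl))) ,
      Close∧≢⇒adj rj (r≢ j eq))
      where
      r≢ : ∀ j → toℕ j ≡ suc (length p) → r ≢ lookup (z ∷ q ∷ p) j
      r≢ (suc j) _ = Close∧Far⇒≢ (rx) (Far-sym (All.lookup xp (∈-lookup j)))
    ... | inj₂ (neq , rj) = inj₂ (non-edge , rj)
      where
      non-edge : ¬ CycAdj G _ zero (suc (suc j))
      non-edge (inj₁ ())
      non-edge (inj₂ (inj₁ ()))
      non-edge (inj₂ (inj₂ (inj₁ ())))
      non-edge (inj₂ (inj₂ (inj₂ (e , _)))) = neq (ℕ.suc-injective (ℕ.suc-injective (ℕ.suc-injective e)))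
    pairs (suc i) (suc j) (s≤s i<j) with path-pairs path i j i<j
    ... | inj₁ (eq , e) = inj₁ (inj₁ (cong suc eq) , e)
    ... | inj₂ (neq , far) = inj₂ (non-edge , far)
      where
      non-edge : ¬ CycAdj G _ (suc i) (suc j)
      non-edge (inj₁ e) = neq (ℕ.suc-injective e)
      non-edge (inj₂ (inj₁ e)) = ℕ.<-asym i<j (ℕ.≤-reflexive (ℕ.suc-injective e))
      non-edge (inj₂ (inj₂ (inj₁ (_ , ()))))
      non-edge (inj₂ (inj₂ (inj₂ (_ , ()))))

-- Odd clique minors whose trees are paths

∧-true⁻ : ∀ {b c} → b ∧ c ≡ true → b ≡ true × c ≡ true
∧-true⁻ {true} {true} _ = refl , refl

∨-true⁻ : ∀ {b c} → b ∨ c ≡ true → b ≡ true ⊎ c ≡ true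
∨-true⁻ {true}  _ = inj₁ refl
∨-true⁻ {false} e = inj₂ e

does-true⁻ : ∀ {P : Set} (P? : Dec P) → does P? ≡ true → P
does-true⁻ (yes p) _ = p

even : ℕ → Bool
even zero    = true
even (suc n) = not (even n)

-- Every tree is a path T i 0, T i 1, ..., T i (len i), coloured by the parity of the position.
module _ {n : ℕ} (G : Graph n) (k : ℕ) (len : Fin k → ℕ) (T : Fin k → ℕ → Fin n) where

  path-minor :
    (∀ i j i′ j′ → j ≤ len i → j′ ≤ len i′ → T i j ≡ T i′ j′ → i ≡ i′ × j ≡ j′) →
    (∀ i j → j < len i → adj G (T i (suc j)) (T i j) ≡ true) →
    (∀ i i′ → i ≢ i′ → ∃₂ λ j j′ → j ≤ len i × j′ ≤ len i′ ×
      adj G (T i j) (T i′ j′) ≡ true × even j ≡ even j′) →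
    OddCliqueMinor G k
  path-minor T-injective edge joined = record
    { branch = branch
    ; root = λ i → T i 0
    ; root-in = λ i → branch-T i z≤n
    ; parent = parent
    ; depth = position
    ; parent-ok = parent-ok
    ; colour = even ∘ position
    ; tree-bichromatic = bichromatic
    ; joined = λ i i′ i≢i′ → let j , j′ , j≤ , j′≤ , e , same = joined i i′ i≢i′ in
        T i j , T i′ j′ , branch-T i j≤ , branch-T i′ j′≤ , e ,
        trans (cong even (position-T i j≤)) (trans same (cong even (sym (position-T i′ j′≤))))
    }
    where
    located? : ∀ v → Dec (∃ λ i → ∃ λ (j : Fin (suc (len i))) → T i (toℕ j) ≡ v)
    located? v = Fin.any? (λ i → Fin.any? (λ j → T i (toℕ j) Fin.≟ v))

    location : Fin n → Maybe (Fin k × ℕ)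
    location v with located? v
    ... | yes (i , j , _) = just (i , toℕ j)
    ... | no _ = nothing

    branch : Fin n → Maybe (Fin k)
    branch = Maybe.map proj₁ ∘ location

    -- Vertices outside the trees get the default 0; the conditions on a minor concern tree vertices
    -- only.
    position : Fin n → ℕ
    position = maybe proj₂ 0 ∘ location

    parent : Fin n → Fin n
    parent v = maybe (λ (i , j) → T i (pred j)) v (location v)

    location-T : ∀ i {j} → j ≤ len i → location (T i j) ≡ just (i , j)
    location-T i {j} j≤ with located? (T i j)
    ... | no ¬l = ⊥-elim (¬l (i , Fin.fromℕ< (s≤s j≤) , cong (T i) (Fin.toℕ-fromℕ< (s≤s j≤))))
    ... | yes (i′ , j′ , eq) with T-injective i′ (toℕ j′) i j (ℕ.≤-pred (Fin.toℕ<n j′)) j≤ eq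
    ... | refl , eq′ = cong (λ m → just (i , m)) eq′

    branch-T : ∀ i {j} → j ≤ len i → branch (T i j) ≡ just i
    branch-T i j≤ rewrite location-T i j≤ = refl

    position-T : ∀ i {j} → j ≤ len i → position (T i j) ≡ j
    position-T i j≤ rewrite location-T i j≤ = refl

    parent-T : ∀ i {j} → j ≤ len i → parent (T i j) ≡ T i (pred j)
    parent-T i j≤ rewrite location-T i j≤ = refl

    branch⁻ : ∀ v i → branch v ≡ just i → ∃ λ j → j ≤ len i × v ≡ T i j
    branch⁻ v i eq with located? v
    branch⁻ v i refl | yes (i , j , eq) = toℕ j , ℕ.≤-pred (Fin.toℕ<n j) , sym eq

    parent-ok : ∀ v i → branch v ≡ just i → v ≢ T i 0 →
      branch (parent v) ≡ just i × adj G v (parent v) ≡ true × position (parent v) < position v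
    parent-ok v i eq v≢ with branch⁻ v i eq
    ... | zero , _ , refl = ⊥-elim (v≢ refl)
    ... | suc j , j< , refl rewrite parent-T i j< | position-T i j< | position-T i (ℕ.<⇒≤ j<) =
      branch-T i (ℕ.<⇒≤ j<) , edge i j j< , ℕ.≤-refl

    bichromatic : ∀ v i → branch v ≡ just i → v ≢ T i 0 → even (position v) ≢ even (position (parent v))
    bichromatic v i eq v≢ with branch⁻ v i eq
    ... | zero , _ , refl = ⊥-elim (v≢ refl)
    ... | suc j , j< , refl rewrite parent-T i j< | position-T i j< | position-T i (ℕ.<⇒≤ j<) =
      Bool.not-¬ refl ∘ sym

-- Chordal graphs

module _ {n : ℕ} (G : Graph n) where

  Clique : ℕ → Set
  Clique m = Σ (Fin m → Fin n) λ f → Injective _≡_ _≡_ f × (∀ i j → Close G (f i) (f j))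

  Clique⇒OddCliqueMinor : ∀ {m} → Clique m → OddCliqueMinor G m
  Clique⇒OddCliqueMinor {m} (f , inj , cl) = path-minor G m (λ _ → 0) (λ i _ → f i)
    (λ { i zero i′ zero z≤n z≤n eq → inj eq , refl })
    (λ _ _ ())
    (λ i i′ i≢i′ → 0 , 0 , z≤n , z≤n , Close∧≢⇒adj G (cl i i′) (i≢i′ ∘ inj) , refl)

  -- Vertices may repeat and chords are allowed; the shortcuts taken by `attach` later turn a walk
  -- into an induced path.
  data Walk (S : Fin n → Bool) : Fin n → Fin n → Set where
    stop : ∀ {x} → S x ≡ true → Walk S x x
    step : ∀ {x z y} → S x ≡ true → Close G x z → Walk S z y → Walk S x y

  Walk-start : ∀ {S x y} → Walk S x y → S x ≡ true
  Walk-start (stop x∈S) = x∈S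
  Walk-start (step x∈S _ _) = x∈S

  Walk-trans : ∀ {S x y z} → Walk S x y → Walk S y z → Walk S x z
  Walk-trans (stop _) w = w
  Walk-trans (step x∈S e w′) w = step x∈S e (Walk-trans w′ w)

  Walk-sym : ∀ {S x y} → Walk S x y → Walk S y x
  Walk-sym (stop x∈S) = stop x∈S
  Walk-sym (step x∈S e w) =
    Walk-trans (Walk-sym w) (step (Walk-start w) (Close-sym G e) (stop x∈S))

  Walk-mono : ∀ {S S′ x y} → (∀ v → S v ≡ true → S′ v ≡ true) → Walk S x y → Walk S′ x y
  Walk-mono S⊆S′ (stop x∈S) = stop (S⊆S′ _ x∈S)
  Walk-mono S⊆S′ (step x∈S e w) = step (S⊆S′ _ x∈S) e (Walk-mono S⊆S′ w)

  all-far? : ∀ x p → Dec (All (Far G x) p)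
  all-far? x = All.all? (λ v → close G x v Bool.≟ false)

  -- Shortcut from s to the last vertex of the arc that is close to s.
  attach : ∀ {r y z p} s → Far G r s → Arc G r y z p → ¬ All (Far G s) (z ∷ p) → ∃ (Arc G r y s)
  attach s rs (end ry) ¬far = _ , step rs (¬false⇒true (λ f → ¬far (f ∷ []))) [] (end ry)
  attach s rs arc@(step {z = z} {p} _ _ _ arc′) ¬far with all-far? s (z ∷ p)
  ... | yes far = _ , step rs (¬false⇒true (λ f → ¬far (f ∷ far))) far arc
  ... | no ¬far′ = attach s rs arc′ ¬far′

  -- From the last vertex of the arc that is close to `x`, the rest of the arc closes up with `r`
  -- and `x`. As `x` is far from `y`, that vertex is not `y`, so the cycle has at least four
  -- vertices.
  close-up : ∀ {r y z p} x → Close G r x → Far G x y → Arc G r y z p → ¬ All (Far G x) (z ∷ p) →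
    ∃ (Hole G)
  close-up x rx xy (end _) ¬far = ⊥-elim (¬far (xy ∷ []))
  close-up x rx xy arc@(step {z = z} {p} _ _ _ arc′) ¬far with all-far? x (z ∷ p)
  ... | yes far = _ , hole rx (¬false⇒true (λ f → ¬far (f ∷ far))) far arc
  ... | no ¬far′ = close-up x rx xy arc′ ¬far′

  Outside : (Fin n → Bool) → Fin n → Set
  Outside S r = ∀ s → S s ≡ true → Far G r s

  outside? : ∀ S r → Dec (Outside S r)
  outside? S r = Fin.all? (λ s → (S s Bool.≟ true) →-dec (close G r s Bool.≟ false))

  -- Starting from `y`, the vertices of the walk are attached in reverse order. They lie in `S` and
  -- hence are far from `r`, so `y` stays the only vertex close to `r`.
  Walk⇒Arc : ∀ {S r y s t} → Outside S r → Close G r y → Close G t y → Walk S s t → ∃ (Arc G r y s)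
  Walk⇒Arc out ry ty (stop s∈S) = _ , step (out _ s∈S) ty [] (end ry)
  Walk⇒Arc out ry ty (step s∈S sz w) =
    attach _ (out _ s∈S) (proj₂ (Walk⇒Arc out ry ty w)) (λ { (f ∷ _) → true≢false sz f })

  Connected : (Fin n → Bool) → Set
  Connected S = ∀ s t → S s ≡ true → S t ≡ true → Walk S s t

  -- The argument that minimal separators of chordal graphs are cliques: if `x` and `y` were far
  -- apart, an induced path between them with interior in `S` would form a hole with `r`.
  separator-close : (∀ {k} → ¬ Hole G k) → ∀ {S r x y s t} → Connected S → Outside S r →
    S s ≡ true → S t ≡ true → Close G x s → Close G y t → Close G r x → Close G r y → Close G x y
  separator-close no-hole {x = x} conn out s∈S t∈S xs yt rx ry = ¬false⇒true λ xy →
    no-hole (proj₂ (close-up x rx xy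
      (proj₂ (Walk⇒Arc out ry (Close-sym G yt) (conn _ _ s∈S t∈S)))
      (λ { (f ∷ _) → true≢false xs f })))

  insert : Fin n → (Fin n → Bool) → Fin n → Bool
  insert y S v = S v ∨ does (v Fin.≟ y)

  insert-⊆ : ∀ y S v → S v ≡ true → insert y S v ≡ true
  insert-⊆ y S v v∈S rewrite v∈S = refl

  insert-∋ : ∀ y S → insert y S y ≡ true
  insert-∋ y S rewrite dec-true (y Fin.≟ y) refl = Bool.∨-zeroʳ _

  insert⁻ : ∀ y S v → insert y S v ≡ true → S v ≡ true ⊎ v ≡ y
  insert⁻ y S v e with ∨-true⁻ {S v} e
  ... | inj₁ v∈S = inj₁ v∈S
  ... | inj₂ v≟y = inj₂ (does-true⁻ (v Fin.≟ y) v≟y)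

  insert-connected : ∀ {y S s} → Connected S → S s ≡ true → Close G y s → Connected (insert y S)
  insert-connected {y} {S} {s} conn s∈S ys u v u∈ v∈ = Walk-trans (to u u∈) (Walk-sym (to v v∈))
    where
    to : ∀ u → insert y S u ≡ true → Walk (insert y S) u s
    to u u∈ with insert⁻ y S u u∈
    ... | inj₁ u∈S = Walk-mono (insert-⊆ y S) (conn u s u∈S s∈S)
    ... | inj₂ refl = step (insert-∋ y S) ys (stop (insert-⊆ y S s s∈S))

  -- Local form of maximality: a vertex `y` that sees `S` but not some outside vertex `r` could be
  -- added to `S`, leaving `S` connected and `r` outside.
  Saturated : (U S : Fin n → Bool) → Set
  Saturated U S = ∀ y s r → S y ≡ false → S s ≡ true → Close G y s →
    U r ≡ true → Outside S r → Close G y r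

  -- Vertices violating saturation are added one by one; `m` bounds the number of vertices not yet
  -- in `S`.
  saturate : ∀ m U S v → S v ≡ true → Connected S → (∃ λ r → U r ≡ true × Outside S r) →
    size (not ∘ S) ≤ m →
    ∃ λ S′ → S′ v ≡ true × Connected S′ × (∃ λ r → U r ≡ true × Outside S′ r) × Saturated U S′
  saturate m U S v v∈S conn outside ≤m with Fin.any? (λ y → Fin.any? (λ s → Fin.any? (λ r →
    (S y Bool.≟ false) ×-dec (S s Bool.≟ true) ×-dec (close G y s Bool.≟ true) ×-dec
    (U r Bool.≟ true) ×-dec outside? S r ×-dec (close G y r Bool.≟ false))))
  ... | no none = S , v∈S , conn , outside , λ y s r y∉ s∈ ys r∈ out →
    ¬false⇒true (λ yr → none (y , s , r , y∉ , s∈ , ys , r∈ , out , yr))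
  saturate m U S v v∈S conn outside ≤m | yes (y , s , r , y∉S , s∈S , ys , r∈U , out , yr) =
    next m ≤m
    where
    smaller : size (not ∘ insert y S) < size (not ∘ S)
    smaller = size-strict (λ w w∉ → cong not (¬true⇒false (λ w∈ →
        true≢false w∉ (cong not (insert-⊆ y S w w∈)))))
      y (cong not y∉S) (cong not (insert-∋ y S))
    out′ : Outside (insert y S) r
    out′ w w∈ with insert⁻ y S w w∈
    ... | inj₁ w∈S = out w w∈S
    ... | inj₂ refl = Far-sym G yr
    next : ∀ m → size (not ∘ S) ≤ m →
      ∃ λ S′ → S′ v ≡ true × Connected S′ × (∃ λ r → U r ≡ true × Outside S′ r) × Saturated U S′
    next zero ≤m = ⊥-elim (ℕ.n≮0 (ℕ.≤-trans smaller ≤m))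
    next (suc m) ≤m = saturate m U (insert y S) v (insert-⊆ y S v v∈S)
      (insert-connected conn s∈S ys) (r , r∈U , out′) (ℕ.≤-pred (ℕ.≤-trans smaller ≤m))

  Simplicial : (Fin n → Bool) → Fin n → Set
  Simplicial U w = ∀ x y → U x ≡ true → U y ≡ true → Close G w x → Close G w y → Close G x y

  singleton : Fin n → Fin n → Bool
  singleton v w = does (w Fin.≟ v)

  singleton-connected : ∀ v → Connected (singleton v)
  singleton-connected v s t s∈ t∈ with does-true⁻ (s Fin.≟ v) s∈ | does-true⁻ (t Fin.≟ v) t∈
  ... | refl | refl = stop s∈

  -- Take a maximal connected S such that R, the part of U that S does not see, is nonempty.
  -- The neighbours of R outside R form a clique complete to R, so a simplicial vertex of R is
  -- simplicial in U.
  simplicial-vertex : (∀ {k} → ¬ Hole G k) → ∀ m U → size U ≤ m → ∀ u → U u ≡ true →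
    ∃ λ w → U w ≡ true × Simplicial U w
  simplicial-vertex no-hole zero U ≤m u u∈U =
    ⊥-elim (Fin.¬Fin0 (subst Fin (ℕ.n≤0⇒n≡0 ≤m) (rank U u u∈U)))
  simplicial-vertex no-hole (suc m) U ≤m u u∈U with Fin.any? (λ v → Fin.any? (λ r →
    (U v Bool.≟ true) ×-dec (U r Bool.≟ true) ×-dec (close G v r Bool.≟ false)))
  ... | no none = u , u∈U , λ x y x∈ y∈ _ _ → ¬false⇒true (λ xy → none (x , y , x∈ , y∈ , xy))
  ... | yes (v , r , v∈U , r∈U , vr)
    -- Unless `U` is a clique it contains far vertices `v` and `r`, and the growth starts from the
    -- set consisting of `v`. Since `v` stays in `S`, it is missing from `R`, so the recursion is on
    -- a smaller set.
    with saturate _ U (singleton v) v (dec-true (v Fin.≟ v) refl) (singleton-connected v)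
      (r , r∈U , λ s s∈ → Far-sym G (subst (λ s → Far G s r) (sym (does-true⁻ (s Fin.≟ v) s∈)) vr))
      ℕ.≤-refl
  ... | S , v∈S , conn , (r′ , r′∈U , out) , saturated =
    let w , w∈R , w-simplicial =
          simplicial-vertex no-hole m R (ℕ.≤-pred (ℕ.≤-trans R<U ≤m)) r′ (R⁺ r′ r′∈U out)
    in w , proj₁ (R⁻ w w∈R) , extend w w∈R w-simplicial
    where
    R : Fin n → Bool
    R x = U x ∧ does (outside? S x)
    R⁺ : ∀ x → U x ≡ true → Outside S x → R x ≡ true
    R⁺ x x∈U out = cong₂ _∧_ x∈U (dec-true (outside? S x) out)
    R⁻ : ∀ x → R x ≡ true → U x ≡ true × Outside S x
    R⁻ x x∈R = let x∈U , o = ∧-true⁻ {U x} x∈R in x∈U , does-true⁻ (outside? S x) o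
    R<U : size R < size U
    R<U = size-strict (λ x → proj₁ ∘ R⁻ x) v v∈U
      (¬true⇒false (λ v∈R → true≢false (close-refl G v) (proj₂ (R⁻ v v∈R) v v∈S)))
    extend : ∀ w → R w ≡ true → Simplicial R w → Simplicial U w
    extend w w∈R simplicial x y x∈U y∈U wx wy = by-cases (sees x x∈U wx) (sees y y∈U wy)
      where
      Boundary : Fin n → Set
      Boundary x = ∃ λ s → S s ≡ true × Close G x s × S x ≡ false
      sees : ∀ x → U x ≡ true → Close G w x → R x ≡ true ⊎ Boundary x
      sees x x∈U wx with Fin.any? (λ s → (S s Bool.≟ true) ×-dec (close G x s Bool.≟ true))
      ... | yes (s , s∈S , xs) =
        inj₂ (s , s∈S , xs , ¬true⇒false (λ x∈S → true≢false wx (proj₂ (R⁻ w w∈R) x x∈S)))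
      ... | no none = inj₁ (R⁺ x x∈U (λ s s∈S → ¬true⇒false (λ xs → none (s , s∈S , xs))))
      complete : ∀ {x y} → Boundary x → R y ≡ true → Close G x y
      complete {y = y} (s , s∈S , xs , x∉S) y∈R =
        let y∈U , y-out = R⁻ y y∈R in saturated _ s y x∉S s∈S xs y∈U y-out
      by-cases : R x ≡ true ⊎ Boundary x → R y ≡ true ⊎ Boundary y → Close G x y
      by-cases (inj₁ x∈R) (inj₁ y∈R) = simplicial x y x∈R y∈R wx wy
      by-cases (inj₁ x∈R) (inj₂ y∈B) = Close-sym G (complete y∈B x∈R)
      by-cases (inj₂ x∈B) (inj₁ y∈R) = complete x∈B y∈R
      -- Here `w` itself is the vertex outside `S` with which a path between `x` and `y` through `S`
      -- would form a hole.
      by-cases (inj₂ (s , s∈S , xs , _)) (inj₂ (t , t∈S , yt , _)) =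
        separator-close no-hole conn (proj₂ (R⁻ w w∈R)) s∈S t∈S xs yt wx wy

  PartialColouring : (Fin n → Bool) → ℕ → (Fin n → ℕ) → Set
  PartialColouring U k col = (∀ v → U v ≡ true → col v < k) ×
    (∀ u v → U u ≡ true → U v ≡ true → adj G u v ≡ true → col u ≢ col v)

  -- Greedy along a perfect elimination order: if all k colours occur around a simplicial
  -- vertex, it lies in a clique of size k + 1.
  chordal-clique-or-colouring : (∀ {k} → ¬ Hole G k) → ∀ k m U → size U ≤ m →
    Clique (suc k) ⊎ ∃ (PartialColouring U k)
  chordal-clique-or-colouring no-hole k m U ≤m with Fin.any? (λ u → U u Bool.≟ true)
  ... | no empty = inj₂ ((λ _ → 0) , (λ v v∈ → ⊥-elim (empty (v , v∈))) ,
    λ u _ u∈ → ⊥-elim (empty (u , u∈)))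
  chordal-clique-or-colouring no-hole k zero U ≤m | yes (u , u∈U) =
    ⊥-elim (Fin.¬Fin0 (subst Fin (ℕ.n≤0⇒n≡0 ≤m) (rank U u u∈U)))
  chordal-clique-or-colouring no-hole k (suc m) U ≤m | yes (u , u∈U)
    with simplicial-vertex no-hole _ U ℕ.≤-refl u u∈U
  ... | w , w∈U , simplicial = extend (chordal-clique-or-colouring no-hole k m U′
      (ℕ.≤-pred (ℕ.≤-trans (size-strict (λ v → proj₁ ∘ U′⁻ v) w w∈U w∉U′) ≤m)))
    where
    U′ : Fin n → Bool
    U′ v = U v ∧ not (does (v Fin.≟ w))
    w∉U′ : U′ w ≡ false
    w∉U′ rewrite dec-true (w Fin.≟ w) refl = Bool.∧-zeroʳ _
    U′⁻ : ∀ v → U′ v ≡ true → U v ≡ true × v ≢ w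
    U′⁻ v v∈ = proj₁ (∧-true⁻ {U v} v∈) , λ { refl → true≢false v∈ w∉U′ }
    U′⁺ : ∀ v → U v ≡ true → v ≢ w → U′ v ≡ true
    U′⁺ v v∈ v≢w = cong₂ _∧_ v∈ (cong not (dec-false (v Fin.≟ w) v≢w))
    extend : Clique (suc k) ⊎ ∃ (PartialColouring U′ k) → Clique (suc k) ⊎ ∃ (PartialColouring U k)
    extend (inj₁ clique) = inj₁ clique
    extend (inj₂ (col , bound , proper)) = by-cases (Fin.all? occurs?)
      where
      Occurs : Fin k → Set
      Occurs x = ∃ λ u → U′ u ≡ true × Close G w u × col u ≡ toℕ x
      occurs? : ∀ x → Dec (Occurs x)
      occurs? x = Fin.any? (λ u →
        (U′ u Bool.≟ true) ×-dec (close G w u Bool.≟ true) ×-dec (col u ℕ.≟ toℕ x))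

      enlarge : (∀ x → Occurs x) → Clique (suc k)
      enlarge occurs = f , f-injective , f-close
        where
        f : Fin (suc k) → Fin n
        f zero    = w
        f (suc x) = proj₁ (occurs x)
        w≢f : ∀ x → w ≢ f (suc x)
        w≢f x eq = proj₂ (U′⁻ _ (proj₁ (proj₂ (occurs x)))) (sym eq)
        f-injective : Injective _≡_ _≡_ f
        f-injective {zero}  {zero}  _  = refl
        f-injective {zero}  {suc y} eq = ⊥-elim (w≢f y eq)
        f-injective {suc x} {zero}  eq = ⊥-elim (w≢f x (sym eq))
        f-injective {suc x} {suc y} eq = cong suc (Fin.toℕ-injective
          (trans (sym (proj₂ (proj₂ (proj₂ (occurs x)))))
            (trans (cong col eq) (proj₂ (proj₂ (proj₂ (occurs y)))))))
        w-close : ∀ x → Close G w (f x)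
        w-close zero    = close-refl G w
        w-close (suc x) = proj₁ (proj₂ (proj₂ (occurs x)))
        f∈U : ∀ x → U (f x) ≡ true
        f∈U zero    = w∈U
        f∈U (suc x) = proj₁ (U′⁻ _ (proj₁ (proj₂ (occurs x))))
        f-close : ∀ x y → Close G (f x) (f y)
        f-close x y = simplicial _ _ (f∈U x) (f∈U y) (w-close x) (w-close y)

      recolour : ∀ x → ¬ Occurs x → ∃ (PartialColouring U k)
      recolour x free = col′ , bound′ , proper′
        where
        col′ : Fin n → ℕ
        col′ v with v Fin.≟ w
        ... | yes _ = toℕ x
        ... | no _  = col v
        bound′ : ∀ v → U v ≡ true → col′ v < k
        bound′ v v∈ with v Fin.≟ w
        ... | yes _  = Fin.toℕ<n x
        ... | no v≢w = bound v (U′⁺ v v∈ v≢w)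
        proper′ : ∀ u v → U u ≡ true → U v ≡ true → adj G u v ≡ true → col′ u ≢ col′ v
        proper′ u v u∈ v∈ e eq with u Fin.≟ w | v Fin.≟ w
        ... | yes refl | yes refl = adj⇒≢ G e refl
        ... | yes refl | no v≢w = free (v , U′⁺ v v∈ v≢w , adj⇒Close G e , sym eq)
        ... | no u≢w | yes refl = free (u , U′⁺ u u∈ u≢w , Close-sym G (adj⇒Close G e) , eq)
        ... | no u≢w | no v≢w = proper u v (U′⁺ u u∈ u≢w) (U′⁺ v v∈ v≢w) e eq

      by-cases : Dec (∀ x → Occurs x) → Clique (suc k) ⊎ ∃ (PartialColouring U k)
      by-cases (yes occurs) = inj₁ (enlarge occurs)
      by-cases (no ¬occurs) =
        let x , free = Fin.¬∀⟶∃¬ k Occurs occurs? ¬occurs in inj₂ (recolour x free)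

  bounded-colouring : ∀ {k} (col : Fin n → ℕ) → (∀ v → col v < k) →
    (∀ u v → adj G u v ≡ true → col u ≢ col v) → Colourable G k
  bounded-colouring col bound proper = (λ v → Fin.fromℕ< (bound v)) , λ u v e eq →
    proper u v e (trans (sym (Fin.toℕ-fromℕ< (bound u))) (trans (cong toℕ eq) (Fin.toℕ-fromℕ< (bound v))))

  -- If the chromatic number is `suc k`, there is no colouring with `k` colours, so the dichotomy
  -- yields a clique of size `suc k`.
  chordal-bound : (∀ {k} → ¬ Hole G k) → ∀ {c h} →
    IsChromaticNumber G c → IsOddHadwigerNumber G h → c ≤ h
  chordal-bound no-hole {zero} _ _ = z≤n
  chordal-bound no-hole {suc k} (_ , minimal) (_ , maximal)
    with chordal-clique-or-colouring no-hole k _ (λ _ → true) ℕ.≤-refl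
  ... | inj₁ clique = maximal _ (Clique⇒OddCliqueMinor clique)
  ... | inj₂ (col , bound , proper) = ⊥-elim (ℕ.1+n≰n (minimal k
    (bounded-colouring col (λ v → bound v refl) (λ u v → proper u v refl refl))))

-- Periodic sequences

module Periodic {A : Set} (l : ℕ) (f : ℕ → A) (period : ∀ i → f (suc l + i) ≡ f i) where

  periodic-% : ∀ i → f i ≡ f (i % suc l)
  periodic-% i = trans (cong f (trans (m≡m%n+[m/n]*n i (suc l)) (ℕ.+-comm (i % suc l) _)))
    (multiple (i / suc l) (i % suc l))
    where
    multiple : ∀ k r → f (k * suc l + r) ≡ f r
    multiple zero    r = refl
    multiple (suc k) r =
      trans (cong f (ℕ.+-assoc (suc l) (k * suc l) r)) (trans (period _) (multiple k r))

  -- A full period may start at any `b`: raising `b` by one only trades the index `b` for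
  -- `l + suc b`.
  periodic-from : ∀ b i → ∃ λ j → j ≤ l × f i ≡ f (j + b)
  periodic-from zero i = i % suc l , ℕ.≤-pred (m%n<n i (suc l)) ,
    trans (periodic-% i) (cong f (sym (ℕ.+-identityʳ _)))
  periodic-from (suc b) i with periodic-from b i
  ... | zero , _ , eq = l , ℕ.≤-refl , trans eq (trans (sym (period b)) (cong f (sym (ℕ.+-suc l b))))
  ... | suc j , j< , eq = j , ℕ.<⇒≤ j< , trans eq (cong f (sym (ℕ.+-suc j b)))

  -- Stated for an arbitrary total preorder so that it yields both a maximum and, with the order
  -- flipped, a minimum.
  periodic-extremum : {_≼_ : A → A → Set} → IsTotalPreorder _≡_ _≼_ → ∃ λ i → ∀ j → f j ≼ f i
  periodic-extremum {_≼_} isTotalPreorder =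
    let i , max = below l in
    i , λ j → subst (_≼ f i) (sym (periodic-% j)) (max _ (ℕ.≤-pred (m%n<n j (suc l))))
    where
    open IsTotalPreorder isTotalPreorder using (total) renaming (refl to ≼-refl; trans to ≼-trans)
    below : ∀ m → ∃ λ i → ∀ j → j ≤ m → f j ≼ f i
    below zero = 0 , λ { zero z≤n → ≼-refl }
    below (suc m) with below m
    ... | i , max with total (f i) (f (suc m))
    ... | inj₁ fi≼ = suc m , λ j j≤ → case ℕ.m≤n⇒m<n∨m≡n j≤ of λ where
      (inj₁ j<) → ≼-trans (max j (ℕ.≤-pred j<)) fi≼
      (inj₂ refl) → ≼-refl
    ... | inj₂ ≼fi = i , λ j j≤ → case ℕ.m≤n⇒m<n∨m≡n j≤ of λ where
      (inj₁ j<) → max j (ℕ.≤-pred j<)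
      (inj₂ refl) → ≼fi

open Periodic

-- Vertex classes around a cycle of length 2α + 1

-- The cycle C₂ₐ₊₁ with a = 2 + a′, read as a periodic sequence; its length is 5 + e with e = 2 a′.
module Inflation {n : ℕ} (G : Graph n) (a′ : ℕ) (α : IsIndependenceNumber G (2 + a′))
  (no-hole : ∀ {m} → m ≤ a′ + a′ → ¬ Hole G (4 + m))
  (F : ℕ → Fin n)
  (F-period : ∀ i → F (5 + (a′ + a′) + i) ≡ F i)
  (F-close : ∀ i → Close G (F i) (F (suc i)))
  -- In a cycle of length `5 + e`, the forward distances between distinct non-adjacent vertices are
  -- 2 to `3 + e`.
  (F-far : ∀ i j → 2 + i ≤ j → j ≤ 3 + (a′ + a′) + i → Far G (F i) (F j))
  where

  e : ℕ
  e = a′ + a′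

  window : ℕ → ℕ → List (Fin n)
  window q zero    = []
  window q (suc m) = F q ∷ window (suc q) m

  length-window : ∀ q m → length (window q m) ≡ m
  length-window q zero    = refl
  length-window q (suc m) = cong suc (length-window (suc q) m)

  window-all : ∀ {P : Fin n → Set} q m → (∀ j → q ≤ j → j < m + q → P (F j)) → All P (window q m)
  window-all q zero    all = []
  window-all q (suc m) all = all q ℕ.≤-refl (s≤s (ℕ.m≤n+m q m)) ∷
    window-all (suc q) m (λ j q<j j< → all j (ℕ.<⇒≤ q<j) (subst (j <_) (ℕ.+-suc m q) j<))

  F-far-window : ∀ p m → m ≤ 2 + e → All (Far G (F p)) (window (2 + p) m)
  F-far-window p m m≤ = window-all (2 + p) m λ j p<j j< → F-far p j p<j
    (ℕ.≤-pred (ℕ.≤-trans j< (ℕ.≤-trans (ℕ.≤-reflexive (trans (ℕ.+-suc m (suc p)) (cong suc (ℕ.+-suc m p))))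
      (s≤s (s≤s (ℕ.+-monoˡ-≤ p m≤))))))

  window-arc : ∀ {r} p m → m ≤ 3 + e → (∀ q → p ≤ q → q < m + p → Far G r (F q)) →
    Close G r (F (m + p)) → Arc G r (F (m + p)) (F p) (window (suc p) m)
  window-arc p zero m≤ far cl = end cl
  window-arc {r} p (suc m) m≤ far cl =
    step (far p ℕ.≤-refl (s≤s (ℕ.m≤n+m p m))) (F-close p) (F-far-window p m (ℕ.≤-pred m≤))
      (subst (λ t → Arc G r (F t) (F (suc p)) (window (2 + p) m)) (ℕ.+-suc m p)
        (window-arc (suc p) m (ℕ.≤-trans (ℕ.n≤1+n m) m≤)
          (λ q p<q q< → far q (ℕ.<⇒≤ p<q) (subst (q <_) (ℕ.+-suc m p) q<))
          (subst (Close G r ∘ F) (sym (ℕ.+-suc m p)) cl)))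

  -- v, x, F p, ..., F (1 + m + p) would be a hole of length 4 + m.
  no-window-hole : ∀ {v x} p m → m ≤ e → Close G v x → Close G x (F p) →
    (∀ q → 1 + p ≤ q → q ≤ 1 + m + p → Far G x (F q)) →
    (∀ q → p ≤ q → q < 1 + m + p → Far G v (F q)) → Close G v (F (1 + m + p)) → ⊥
  no-window-hole {v} {x} p m m≤e vx xp x-far v-far vq =
    no-hole (subst (_≤ e) (sym (length-window (2 + p) m)) m≤e)
      (hole vx xp
        (window-all (1 + p) (1 + m) (λ q p< q< → x-far q p< (ℕ.≤-pred (subst (q <_) (ℕ.+-suc (1 + m) p) q<))))
        (window-arc p (1 + m) (ℕ.≤-trans (s≤s m≤e) (ℕ.m≤n+m (1 + e) 2)) v-far vq))

  -- The shortest hole: two far vertices cannot have two common neighbours that are far from each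
  -- other.
  no-square : ∀ {v x w y} → Close G v x → Close G x w → Close G w y → Close G y v →
    Far G v w → Far G x y → ⊥
  no-square vx xw wy yv vw xy =
    no-hole z≤n (hole vx xw (xy ∷ []) (step vw wy [] (end (Close-sym G yv))))

  i<j⇒2+2i≤2j : ∀ {i j} → i < j → 2 + (i + i) ≤ j + j
  i<j⇒2+2i≤2j {i} {j} i<j = subst (_≤ j + j) (cong suc (ℕ.+-suc i i)) (ℕ.+-mono-≤ i<j i<j)

  j≤1+a′⇒2j≤2+e : ∀ {j} → j ≤ suc a′ → j + j ≤ 2 + e
  j≤1+a′⇒2j≤2+e {j} j≤ = subst (j + j ≤_) (cong suc (ℕ.+-suc a′ a′)) (ℕ.+-mono-≤ j≤ j≤)

  -- The `2 + a′` vertices `F p`, `F (2 + p)`, ..., `F (2 + e + p)` are independent: the span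
  -- `2 + e` is too short to wrap around to a neighbour.
  every-other-far : ∀ p i j → i < j → j ≤ suc a′ → Far G (F (i + i + p)) (F (j + j + p))
  every-other-far p i j i<j j≤ = F-far _ _ (ℕ.+-monoˡ-≤ p (i<j⇒2+2i≤2j i<j))
    (ℕ.≤-trans (ℕ.+-monoˡ-≤ p (j≤1+a′⇒2j≤2+e j≤))
      (ℕ.≤-trans (ℕ.+-monoʳ-≤ (2 + e) (ℕ.m≤n+m p (i + i))) (ℕ.n≤1+n _)))

  -- Every second vertex of the run, together with `v`, would give α + 1 independent vertices.
  no-far-run : ∀ v p → (∀ q → 1 + p ≤ q → q ≤ 3 + e + p → Far G v (F q)) → ⊥
  no-far-run v p far = independent-bound G α x x-far
    where
    x : ℕ → Fin n
    x zero    = v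
    x (suc i) = F (i + i + suc p)
    x-far : ∀ i j → i < j → j ≤ 2 + a′ → Far G (x i) (x j)
    x-far zero (suc j) _ (s≤s j≤) = far _ (ℕ.m≤n+m _ (j + j))
      (ℕ.≤-trans (ℕ.+-monoˡ-≤ (suc p) (j≤1+a′⇒2j≤2+e j≤)) (ℕ.≤-reflexive (ℕ.+-suc (2 + e) p)))
    x-far (suc i) (suc j) (s≤s i<j) (s≤s j≤) = every-other-far (suc p) i j i<j j≤

  F-ends-far : ∀ p → Far G (F p) (F (3 + e + p))
  F-ends-far p = F-far p (3 + e + p) (ℕ.+-monoˡ-≤ p (s≤s (s≤s z≤n))) ℕ.≤-refl

  -- Membership in the class of the vertices whose close vertices on the cycle are exactly
  -- F (p - 2), F (p - 1) and F p; the two conditions below force this.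
  Member : ℕ → Fin n → Set
  Member p v = Close G v (F p) × Far G v (F (suc p))

  Dominating : Fin n → Set
  Dominating v = ∀ i → Close G v (F i)

  module _ {p : ℕ} {v : Fin n} (mv : Member p v) where

    private
      vp : Close G v (F p)
      vp = proj₁ mv
      vp′ : Far G v (F (suc p))
      vp′ = proj₂ mv

    -- The first later `F q` close to `v` would complete the hole `v`, `F p`, ..., `F q`. The range
    -- stops at `2 + e + p`, where this hole has the largest forbidden length `4 + e`.
    member-far : ∀ q → 1 + p ≤ q → q ≤ 2 + e + p → Far G v (F q)
    member-far = run (suc e) ℕ.≤-refl
      where
      run : ∀ m → m ≤ suc e → ∀ q → 1 + p ≤ q → q ≤ 1 + m + p → Far G v (F q)
      run zero _ q p<q q≤ = subst (Far G v ∘ F) (ℕ.≤-antisym p<q q≤) vp′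
      run (suc m) (s≤s m≤e) q p<q q≤ with ℕ.m≤n⇒m<n∨m≡n q≤
      ... | inj₁ (s≤s q≤′) = run m (ℕ.m≤n⇒m≤1+n m≤e) q p<q q≤′
      ... | inj₂ refl = ¬true⇒false λ vq → no-window-hole (suc p) m m≤e vp (F-close p)
        (λ q 2+p≤q q≤ → F-far p q 2+p≤q (ℕ.≤-trans q≤ (ℕ.≤-trans (ℕ.≤-reflexive (ℕ.+-suc (suc m) p))
          (ℕ.≤-trans (s≤s (s≤s (ℕ.+-monoˡ-≤ p m≤e))) (ℕ.n≤1+n _)))))
        (λ q p<q q< → run m (ℕ.m≤n⇒m≤1+n m≤e) q p<q (ℕ.≤-pred (subst (q <_) (ℕ.+-suc (1 + m) p) q<)))
        (subst (Close G v ∘ F) (sym (ℕ.+-suc (1 + m) p)) vq)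

    -- Modulo the period this is `F (p - 2)`. If it were far from `v` as well, `no-far-run` would
    -- apply.
    member-first : Close G v (F (3 + e + p))
    member-first = ¬false⇒true λ far → no-far-run v p λ q p<q q≤ → case ℕ.m≤n⇒m<n∨m≡n q≤ of λ where
      (inj₁ (s≤s q≤′)) → member-far q p<q q≤′
      (inj₂ refl) → far

    -- Modulo the period this is `F (p - 1)`. If it were far from `v`, the vertices `v`,
    -- `F (p - 2)`, `F (p - 1)`, `F p` would form a square.
    member-middle : Close G v (F (4 + e + p))
    member-middle = ¬false⇒true λ far → no-square member-first (F-close (3 + e + p))
      (subst (Close G (F (4 + e + p))) (F-period p) (F-close (4 + e + p)))
      (Close-sym G vp) far (Far-sym G (F-ends-far p))

  -- By `no-far-run`, `v` sees some `F t`. If it misses a vertex of the cycle, going back from there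
  -- towards `F t` meets a close vertex followed by a far one.
  member-or-dominating : ∀ v → Dominating v ⊎ ∃ λ p → Member p v
  member-or-dominating v with Fin.all? (λ (i : Fin (5 + e)) → close G v (F (toℕ i)) Bool.≟ true)
  ... | yes all = inj₁ λ i → trans (periodic-% (4 + e) (close G v ∘ F) (cong (close G v) ∘ F-period) i)
    (subst (Close G v ∘ F) (Fin.toℕ-fromℕ< (m%n<n i (5 + e))) (all (Fin.fromℕ< (m%n<n i (5 + e)))))
  ... | no ¬all = inj₂ (leave i₀ v-far)
    where
    some-far : ∃ λ (i : Fin (5 + e)) → close G v (F (toℕ i)) ≢ true
    some-far = Fin.¬∀⟶∃¬ _ _ (λ i → close G v (F (toℕ i)) Bool.≟ true) ¬all
    some-close : ∃ λ (i : Fin (5 + e)) → Close G v (F (toℕ i))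
    some-close with Fin.any? (λ (i : Fin (5 + e)) → close G v (F (toℕ i)) Bool.≟ true)
    ... | yes c = c
    ... | no none = ⊥-elim (no-far-run v 0 λ q _ q≤ → ¬true⇒false λ vq →
      let q< = s≤s (ℕ.≤-trans q≤ (ℕ.≤-trans (ℕ.≤-reflexive (ℕ.+-identityʳ (3 + e))) (ℕ.n≤1+n _))) in
      none (Fin.fromℕ< q< , subst (Close G v ∘ F) (sym (Fin.toℕ-fromℕ< q<)) vq))
    t : ℕ
    t = toℕ (proj₁ some-close)
    rebased : ∃ λ j → j ≤ 4 + e × close G v (F (toℕ (proj₁ some-far))) ≡ close G v (F (j + t))
    rebased = periodic-from (4 + e) (close G v ∘ F) (cong (close G v) ∘ F-period) t _
    i₀ : ℕ
    i₀ = proj₁ rebased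
    v-far : Far G v (F (i₀ + t))
    v-far = trans (sym (proj₂ (proj₂ rebased))) (¬true⇒false (proj₂ some-far))
    leave : ∀ j → Far G v (F (j + t)) → ∃ λ p → Member p v
    leave zero    far = ⊥-elim (true≢false (proj₂ some-close) far)
    leave (suc j) far with true-or-false (close G v (F (j + t)))
    ... | inj₁ vj = j + t , vj , far
    ... | inj₂ vj = leave j vj

  -- Here and in the next two lemmas, both vertices are close to two cycle vertices that are far
  -- from each other, so being far apart would create a square.
  dominating-close : ∀ {v w} → Dominating v → Dominating w → Close G v w
  dominating-close dv dw = ¬false⇒true λ vw →
    no-square (dv 0) (Close-sym G (dw 0)) (dw (3 + e + 0)) (Close-sym G (dv (3 + e + 0))) vw (F-ends-far 0)

  dominating-member-close : ∀ {p v w} → Dominating v → Member p w → Close G v w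
  dominating-member-close {p} dv mw = ¬false⇒true λ vw →
    no-square (dv p) (Close-sym G (proj₁ mw)) (member-first mw) (Close-sym G (dv (3 + e + p))) vw (F-ends-far p)

  same-class-close : ∀ {p v w} → Member p v → Member p w → Close G v w
  same-class-close {p} mv mw = ¬false⇒true λ vw →
    no-square (proj₁ mv) (Close-sym G (proj₁ mw)) (member-first mw) (Close-sym G (member-first mv)) vw
      (F-ends-far p)

  -- Both vertices are far from `F (2 + p)`, `F (4 + p)`, ..., `F (2 + e + p)`. These are `1 + a′`
  -- independent vertices, so if `v` and `w` were far apart there would be `3 + a′`, one more than
  -- α.
  next-class-close : ∀ {p v w} → Member p v → Member (suc p) w → Close G v w
  next-class-close {p} {v} {w} mv mw = ¬false⇒true λ vw → independent-bound G α x (x-far vw)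
    where
    x : ℕ → Fin n
    x zero          = v
    x (suc zero)    = w
    x (suc (suc i)) = F (i + i + (2 + p))
    2+p≤ : ∀ i → 2 + p ≤ i + i + (2 + p)
    2+p≤ i = ℕ.m≤n+m _ (i + i)
    ≤2+e+p : ∀ {i} → i ≤ a′ → i + i + (2 + p) ≤ 2 + e + p
    ≤2+e+p {i} i≤ = ℕ.≤-trans (ℕ.+-monoˡ-≤ (2 + p) (ℕ.+-mono-≤ i≤ i≤))
      (ℕ.≤-reflexive (trans (ℕ.+-suc e (suc p)) (cong suc (ℕ.+-suc e p))))
    x-far : Far G v w → ∀ i j → i < j → j ≤ 2 + a′ → Far G (x i) (x j)
    x-far vw zero (suc zero) _ _ = vw
    x-far vw zero (suc (suc j)) _ (s≤s (s≤s j≤)) =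
      member-far mv _ (ℕ.<⇒≤ (2+p≤ j)) (≤2+e+p j≤)
    x-far vw (suc zero) (suc (suc j)) _ (s≤s (s≤s j≤)) =
      member-far mw _ (2+p≤ j) (ℕ.≤-trans (≤2+e+p j≤) (ℕ.+-monoʳ-≤ (2 + e) (ℕ.n≤1+n p)))
    x-far vw (suc (suc i)) (suc (suc j)) (s≤s (s≤s i<j)) (s≤s (s≤s j≤)) =
      every-other-far (2 + p) i j i<j (ℕ.m≤n⇒m≤1+n j≤)
    x-far vw (suc zero) (suc zero) (s≤s ()) _

  member-period : ∀ {p v} → Member p v → Member (5 + e + p) v
  member-period {p} {v} (vp , vp′) = subst (Close G v) (sym (F-period p)) vp ,
    subst (Far G v) (trans (sym (F-period (suc p))) (cong F (ℕ.+-suc (5 + e) p))) vp′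

  -- Otherwise v, w, F (d + p), ..., F (3 + e + p) is a hole of length 6 + e - d.
  distant-class-far′ : ∀ {p v w} d → 2 ≤ d → d ≤ 2 + e → Member p v → Member (d + p) w → Far G v w
  distant-class-far′ {p} {v} {w} d 2≤d d≤ mv mw = ¬true⇒false λ vw →
    no-window-hole (d + p) m m≤e vw (proj₁ mw)
      (λ q dp<q q≤ → member-far mw q dp<q (ℕ.≤-trans q≤ (s≤s (ℕ.≤-trans (ℕ.+-monoˡ-≤ (d + p) m≤e)
        (ℕ.n≤1+n _)))))
      (λ q dp≤q q< → member-far mv q (ℕ.≤-trans (ℕ.+-monoˡ-≤ p (ℕ.<⇒≤ 2≤d)) dp≤q)
        (ℕ.≤-pred (subst (q <_) total q<)))
      (subst (Close G v ∘ F) (sym total) (member-first mv))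
    where
    m : ℕ
    m = proj₁ (ℕ.m≤n⇒∃[o]m+o≡n d≤)
    d+m : d + m ≡ 2 + e
    d+m = proj₂ (ℕ.m≤n⇒∃[o]m+o≡n d≤)
    m≤e : m ≤ e
    m≤e = ℕ.≤-pred (ℕ.≤-pred (ℕ.≤-trans (ℕ.+-monoˡ-≤ m 2≤d) (ℕ.≤-reflexive d+m)))
    total : 1 + m + (d + p) ≡ 3 + e + p
    total = trans (sym (ℕ.+-assoc (1 + m) d p))
      (cong (λ t → suc (t + p)) (trans (ℕ.+-comm m d) d+m))

  distant-class-far : ∀ {p v w} d → 2 ≤ d → d ≤ 3 + e → Member p v → Member (d + p) w → Far G v w
  distant-class-far d 2≤d d≤ mv mw with ℕ.m≤n⇒m<n∨m≡n d≤
  ... | inj₁ (s≤s d≤′) = distant-class-far′ d 2≤d d≤′ mv mw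
  -- At distance `3 + e` the other way round is shorter: class `p` is also class `5 + e + p`, two
  -- steps after that of `w`.
  ... | inj₂ refl = Far-sym G
    (distant-class-far′ 2 (s≤s (s≤s z≤n)) (s≤s (s≤s z≤n)) mw (member-period mv))

  -- Membership at `d + p` asks for `F (d + p)` close and its successor far. The first fails for `d`
  -- up to `2 + e`; for the last two values the successor is `F (p - 1)` or `F p`, which is close.
  member-unique : ∀ {p v} d → 1 ≤ d → d ≤ 4 + e → Member p v → Member (d + p) v → ⊥
  member-unique {p} {v} d 1≤d d≤ mv mv′ with ℕ.m≤n⇒m<n∨m≡n d≤
  ... | inj₂ refl = true≢false (proj₁ mv) (trans (cong (close G v) (sym (F-period p))) (proj₂ mv′))
  ... | inj₁ (s≤s d≤′) with ℕ.m≤n⇒m<n∨m≡n d≤′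
  ... | inj₂ refl = true≢false (member-middle mv) (proj₂ mv′)
  ... | inj₁ (s≤s d≤″) =
    true≢false (proj₁ mv′) (member-far mv (d + p) (ℕ.+-monoˡ-≤ p 1≤d) (ℕ.+-monoˡ-≤ p d≤″))

  class-unique : ∀ {b v} j j′ → j < j′ → j′ ≤ 4 + e → Member (j + b) v → Member (j′ + b) v → ⊥
  class-unique {b} {v} j j′ j<j′ j′≤ mv mv′ with ℕ.m≤n⇒∃[o]m+o≡n j<j′
  ... | d , refl = member-unique (suc d) (s≤s z≤n)
    (ℕ.≤-trans (s≤s (ℕ.m≤n+m d j)) j′≤) mv
    (subst (λ t → Member t v) (cong suc (trans (cong (_+ b) (ℕ.+-comm j d)) (ℕ.+-assoc d j b))) mv′)

  abstract
    member : ℕ → Fin n → Bool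
    member p v = close G v (F p) ∧ not (close G v (F (suc p)))

    member⁺ : ∀ {p v} → Member p v → member p v ≡ true
    member⁺ (vp , vp′) = cong₂ _∧_ vp (cong not vp′)

    member⁻ : ∀ {p v} → member p v ≡ true → Member p v
    member⁻ {p} {v} eq = let vp , vp′ = ∧-true⁻ {close G v (F p)} eq in
      vp , trans (sym (Bool.not-involutive _)) (cong not vp′)

    member-periodic : ∀ v p → member (5 + e + p) v ≡ member p v
    member-periodic v p = cong₂ _∧_ (cong (close G v) (F-period p))
      (cong (not ∘ close G v) (trans (cong F (sym (ℕ.+-suc (5 + e) p))) (F-period (suc p))))

  dominating-not-member : ∀ {p v} → Dominating v → Member p v → ⊥
  dominating-not-member {p} dv (_ , vp′) = true≢false (dv (suc p)) vp′

  abstract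
    -- `Dominating` quantifies over all natural numbers, so it is decided through the dichotomy.
    dominating? : ∀ v → Dec (Dominating v)
    dominating? v = case member-or-dominating v of λ where
      (inj₁ dv) → yes dv
      (inj₂ (p , mv)) → no (λ dv → dominating-not-member dv mv)

  dominating : Fin n → Bool
  dominating v = does (dominating? v)

  dominating⁻ : ∀ {v} → dominating v ≡ true → Dominating v
  dominating⁻ {v} = does-true⁻ (dominating? v)

  N : ℕ → ℕ
  N p = size (member p)

  N-period : ∀ p → N (5 + e + p) ≡ N p
  N-period p = ℕ.≤-antisym
    (size-mono (λ v → trans (sym (member-periodic v p))))
    (size-mono (λ v → trans (member-periodic v p)))

  -- Colouring the inflated cycle

  module Colouring (b ω : ℕ) (N+N≤ω : ∀ p → N p + N (suc p) ≤ ω) where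

    -- The cycle of classes is cut at class `4 + e + b`, which receives colours of its own; the
    -- remaining `4 + e` classes form a path.
    data Slot (v : Fin n) : Set where
      top  : dominating v ≡ true → Slot v
      new  : member (4 + e + b) v ≡ true → Slot v
      path : ∀ j → j ≤ 3 + e → member (j + b) v ≡ true → Slot v

    slot : ∀ v → Slot v
    slot v with member-or-dominating v
    ... | inj₁ dv = top (dec-true (dominating? v) dv)
    ... | inj₂ (p , mv) with periodic-from (4 + e) (λ q → member q v) (member-periodic v) b p
    ... | j , j≤ , eq with ℕ.m≤n⇒m<n∨m≡n j≤
    ... | inj₁ (s≤s j≤′) = path j j≤′ (trans (sym eq) (member⁺ mv))
    ... | inj₂ refl = new (trans (sym eq) (member⁺ mv))

    level : Bool → ℕ → ℕ
    level true  r = r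
    level false r = ω ∸ suc r

    colour-of : ∀ {v} → Slot v → ℕ
    colour-of (top d) = ω + N (4 + e + b) + toℕ (rank dominating _ d)
    colour-of (new m) = ω + toℕ (rank (member _) _ m)
    colour-of (path j _ m) = level (even j) (toℕ (rank (member _) _ m))

    N≤ω : ∀ p → N p ≤ ω
    N≤ω p = ℕ.≤-trans (ℕ.m≤m+n _ _) (N+N≤ω p)

    level< : ∀ t {r} → r < ω → level t r < ω
    level< true  r< = r<
    level< false {r} r< = ℕ.∸-monoʳ-< (s≤s z≤n) r<

    level-injective : ∀ t {r r′} → r < ω → r′ < ω → level t r ≡ level t r′ → r ≡ r′
    level-injective true  _  _   eq = eq
    level-injective false r< r′< eq = ℕ.suc-injective (ℕ.∸-cancelˡ-≡ r< r′< eq)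

    -- Colours counted from opposite ends agree only if `r + suc r′` equals `ω`, which is impossible
    -- when the two classes fit into `ω` together.
    level-disjoint : ∀ t {r r′} → suc r + suc r′ ≤ ω → level t r ≢ level (not t) r′
    level-disjoint true {r} {r′} le eq = ℕ.<⇒≢ le
      (trans (cong (_+ suc r′) eq) (ℕ.m∸n+n≡m (ℕ.≤-trans (ℕ.m≤n+m _ (suc r)) le)))
    level-disjoint false {r} {r′} le eq = ℕ.<⇒≢ le
      (trans (ℕ.+-suc r r′) (trans (cong (λ t → suc r + t) (sym eq)) (ℕ.m+[n∸m]≡n (ℕ.≤-trans (ℕ.m≤m+n (suc r) _) le))))

    rank<ω : ∀ {p v} (m : member p v ≡ true) → toℕ (rank (member p) v m) < ω
    rank<ω {p} m = ℕ.≤-trans (Fin.toℕ<n (rank (member p) _ m)) (N≤ω p)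

    path< : ∀ {v} j j≤ m → colour-of {v} (path j j≤ m) < ω
    path< j _ m = level< (even j) (rank<ω m)

    new< : ∀ {v} m → colour-of {v} (new m) < ω + N (4 + e + b)
    new< m = ℕ.+-monoʳ-< ω (Fin.toℕ<n (rank (member _) _ m))

    colour-bound : ∀ {v} (x : Slot v) → colour-of x < ω + N (4 + e + b) + size dominating
    colour-bound (top d) = ℕ.+-monoʳ-< _ (Fin.toℕ<n (rank dominating _ d))
    colour-bound (new m) = ℕ.≤-trans (new< m) (ℕ.m≤m+n _ _)
    colour-bound (path j j≤ m) = ℕ.≤-trans (path< j j≤ m) (ℕ.≤-trans (ℕ.m≤m+n _ _) (ℕ.m≤m+n _ _))

    -- Consecutive classes are coloured from opposite ends. Classes further apart on the path have
    -- no edges between them, since the cut class separates its two ends.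
    proper-path : ∀ {u v} j j′ j≤ j′≤ m m′ → j < j′ → adj G u v ≡ true →
      colour-of {u} (path j j≤ m) ≢ colour-of {v} (path j′ j′≤ m′)
    proper-path {v = v} j j′ j≤ j′≤ m m′ j<j′ uv with ℕ.m≤n⇒m<n∨m≡n j<j′
    ... | inj₂ refl = level-disjoint (even j)
      (ℕ.≤-trans (ℕ.+-mono-≤ (Fin.toℕ<n (rank (member _) _ m)) (Fin.toℕ<n (rank (member _) _ m′)))
        (N+N≤ω (j + b)))
    ... | inj₁ 2+j≤j′ with ℕ.m≤n⇒∃[o]m+o≡n 2+j≤j′
    ... | d , refl = λ _ → Far⇒¬adj G (distant-class-far (2 + d) (s≤s (s≤s z≤n))
      (ℕ.≤-trans (s≤s (s≤s (ℕ.m≤n+m d j))) j′≤) (member⁻ m)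
      (subst (λ t → Member t v)
        (cong (2 +_) (trans (cong (_+ b) (ℕ.+-comm j d)) (ℕ.+-assoc d j b))) (member⁻ m′))) uv

    proper : ∀ {u v} (x : Slot u) (y : Slot v) → adj G u v ≡ true → colour-of x ≢ colour-of y
    proper (top d) (top d′) uv eq = adj⇒≢ G uv (rank-injective dominating d d′
      (Fin.toℕ-injective (ℕ.+-cancelˡ-≡ (ω + N (4 + e + b)) _ _ eq)))
    proper (top d) (new m) _ eq = ℕ.<⇒≢ (ℕ.≤-trans (new< m) (ℕ.m≤m+n _ _)) (sym eq)
    proper (new m) (top d) _ eq = ℕ.<⇒≢ (ℕ.≤-trans (new< m) (ℕ.m≤m+n _ _)) eq
    proper (top d) (path j j≤ m) _ eq =
      ℕ.<⇒≢ (ℕ.≤-trans (path< j j≤ m) (ℕ.≤-trans (ℕ.m≤m+n _ _) (ℕ.m≤m+n _ _))) (sym eq)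
    proper (path j j≤ m) (top d) _ eq =
      ℕ.<⇒≢ (ℕ.≤-trans (path< j j≤ m) (ℕ.≤-trans (ℕ.m≤m+n _ _) (ℕ.m≤m+n _ _))) eq
    proper (new m) (new m′) uv eq = adj⇒≢ G uv (rank-injective (member _) m m′
      (Fin.toℕ-injective (ℕ.+-cancelˡ-≡ ω _ _ eq)))
    proper (new m) (path j j≤ m′) _ eq = ℕ.<⇒≢ (ℕ.≤-trans (path< j j≤ m′) (ℕ.m≤m+n _ _)) (sym eq)
    proper (path j j≤ m′) (new m) _ eq = ℕ.<⇒≢ (ℕ.≤-trans (path< j j≤ m′) (ℕ.m≤m+n _ _)) eq
    proper {u} {v} (path j j≤ m) (path j′ j′≤ m′) uv eq with ℕ.<-cmp j j′
    ... | tri< j<j′ _ _ = proper-path j j′ j≤ j′≤ m m′ j<j′ uv eq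
    ... | tri≈ _ refl _ = adj⇒≢ G uv (rank-injective (member _) m m′
      (Fin.toℕ-injective (level-injective (even j) (rank<ω m) (rank<ω m′) eq)))
    ... | tri> _ _ j′<j = proper-path j′ j j′≤ j≤ m′ m j′<j (trans (adj-sym G v u) uv) (sym eq)

    colourable : Colourable G (ω + N (4 + e + b) + size dominating)
    colourable = bounded-colouring G (λ v → colour-of (slot v)) (λ v → colour-bound (slot v))
      (λ u v → proper (slot u) (slot v))

  -- An odd clique minor in the inflated cycle

  even-double : ∀ m → even (m + m) ≡ true
  even-double zero    = refl
  even-double (suc m) rewrite ℕ.+-suc m m = trans (Bool.not-involutive _) (even-double m)

  module Minor (b s : ℕ) (s≤N : ∀ p → s ≤ N p) where

    single : Fin n → Bool
    single v = dominating v ∨ (member (3 + e + b) v ∨ member (4 + e + b) v)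

    data Single (v : Fin n) : Set where
      dom   : Dominating v → Single v
      left  : Member (3 + e + b) v → Single v
      right : Member (4 + e + b) v → Single v

    single⁻ : ∀ v → single v ≡ true → Single v
    single⁻ v eq with ∨-true⁻ {dominating v} eq
    ... | inj₁ dv = dom (dominating⁻ dv)
    ... | inj₂ mv with ∨-true⁻ {member (3 + e + b) v} mv
    ... | inj₁ mv = left (member⁻ mv)
    ... | inj₂ mv = right (member⁻ mv)

    size-single : size dominating + (N (3 + e + b) + N (4 + e + b)) ≤ size single
    size-single = ℕ.≤-trans
      (ℕ.+-monoʳ-≤ (size dominating) (size-∨ (member (3 + e + b)) (member (4 + e + b))
        (λ v m m′ → class-unique {b} (3 + e) (4 + e) ℕ.≤-refl ℕ.≤-refl (member⁻ m) (member⁻ m′))))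
      (size-∨ dominating _ λ v d m → case ∨-true⁻ {member (3 + e + b) v} m of λ where
        (inj₁ m) → dominating-not-member (dominating⁻ d) (member⁻ m)
        (inj₂ m) → dominating-not-member (dominating⁻ d) (member⁻ m))

    single-close : ∀ {u v} → Single u → Single v → Close G u v
    single-close (dom d)   (dom d′)   = dominating-close d d′
    single-close (dom d)   (left m)   = dominating-member-close d m
    single-close (dom d)   (right m)  = dominating-member-close d m
    single-close (left m)  (dom d)    = Close-sym G (dominating-member-close d m)
    single-close (right m) (dom d)    = Close-sym G (dominating-member-close d m)
    single-close (left m)  (left m′)  = same-class-close m m′
    single-close (right m) (right m′) = same-class-close m m′
    single-close (left m)  (right m′) = next-class-close m m′
    single-close (right m) (left m′)  = Close-sym G (next-class-close m′ m)

    single-not-path : ∀ {v} j → j ≤ 2 + e → Single v → Member (j + b) v → ⊥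
    single-not-path j j≤ (dom d)   m = dominating-not-member d m
    single-not-path j j≤ (left m′)  m = class-unique {b} j (3 + e) (s≤s j≤) (ℕ.n≤1+n _) m m′
    single-not-path j j≤ (right m′) m = class-unique {b} j (4 + e) (s≤s (ℕ.m≤n⇒m≤1+n j≤)) ℕ.≤-refl m m′

    Index : Set
    Index = Fin (size single) ⊎ Fin s

    len : Index → ℕ
    len (inj₁ _) = 0
    len (inj₂ _) = 2 + e

    T : Index → ℕ → Fin n
    T (inj₁ r) _ = element single r
    T (inj₂ r) j = element (member (j + b)) (Fin.inject≤ r (s≤N (j + b)))

    T-single : ∀ r j → Single (T (inj₁ r) j)
    T-single r j = single⁻ _ (element-∈ single r)

    T-member : ∀ r j → Member (j + b) (T (inj₂ r) j)
    T-member r j = member⁻ (element-∈ (member (j + b)) (Fin.inject≤ r (s≤N (j + b))))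

    T-injective : ∀ x j y j′ → j ≤ len x → j′ ≤ len y → T x j ≡ T y j′ → x ≡ y × j ≡ j′
    T-injective (inj₁ r) zero (inj₁ r′) zero _ _ eq = cong inj₁ (element-injective single eq) , refl
    T-injective (inj₁ r) j (inj₂ r′) j′ _ j′≤ eq =
      ⊥-elim (single-not-path j′ j′≤ (subst Single eq (T-single r j)) (T-member r′ j′))
    T-injective (inj₂ r) j (inj₁ r′) j′ j≤ _ eq =
      ⊥-elim (single-not-path j j≤ (subst Single (sym eq) (T-single r′ j′)) (T-member r j))
    T-injective (inj₂ r) j (inj₂ r′) j′ j≤ j′≤ eq with ℕ.<-cmp j j′
    ... | tri< j<j′ _ _ = ⊥-elim (class-unique {b} j j′ j<j′ (ℕ.≤-trans j′≤ (ℕ.m≤n+m (2 + e) 2))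
      (subst (Member (j + b)) eq (T-member r j)) (T-member r′ j′))
    ... | tri≈ _ refl _ = cong inj₂ (Fin.inject≤-injective _ _ r r′
      (element-injective (member (j + b)) eq)) , refl
    ... | tri> _ _ j′<j = ⊥-elim (class-unique {b} j′ j j′<j (ℕ.≤-trans j≤ (ℕ.m≤n+m (2 + e) 2))
      (subst (Member (j′ + b)) (sym eq) (T-member r′ j′)) (T-member r j))

    T-edge : ∀ x j → j < len x → adj G (T x (suc j)) (T x j) ≡ true
    T-edge (inj₂ r) j j< = Close∧≢⇒adj G
      (Close-sym G (next-class-close (T-member r j) (T-member r (suc j))))
      (λ eq → ℕ.1+n≢n (proj₂ (T-injective (inj₂ r) (suc j) (inj₂ r) j j< (ℕ.<⇒≤ j<) eq)))

    Joined : Index → Index → Set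
    Joined x y = ∃₂ λ j j′ → j ≤ len x × j′ ≤ len y × Close G (T x j) (T y j′) × even j ≡ even j′

    joined-sym : ∀ x y → Joined x y → Joined y x
    joined-sym _ _ (j , j′ , j≤ , j′≤ , c , same) = j′ , j , j′≤ , j≤ , Close-sym G c , sym same

    joined-single : ∀ r r′ → Joined (inj₁ r) (inj₂ r′)
    joined-single r r′ = case T-single r 0 of λ where
      (dom d)   → 0 , 0 , z≤n , z≤n , dominating-member-close d (T-member r′ 0) , refl
      -- Class `3 + e + b` follows the last class of the path, while class `4 + e + b` precedes the
      -- first one modulo the period.
      (left m)  → 0 , 2 + e , z≤n , ℕ.≤-refl , Close-sym G (next-class-close (T-member r′ (2 + e)) m) ,
        sym (trans (Bool.not-involutive _) (even-double a′))
      (right m) → 0 , 0 , z≤n , z≤n , next-class-close m (member-period (T-member r′ 0)) , refl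

    joined : ∀ x y → Joined x y
    joined (inj₁ r) (inj₁ r′) = 0 , 0 , z≤n , z≤n , single-close (T-single r 0) (T-single r′ 0) , refl
    joined (inj₁ r) (inj₂ r′) = joined-single r r′
    joined (inj₂ r) (inj₁ r′) = joined-sym (inj₁ r′) (inj₂ r) (joined-single r′ r)
    -- Any two paths start in the same clique, class `b`.
    joined (inj₂ r) (inj₂ r′) = 0 , 0 , z≤n , z≤n , same-class-close (T-member r 0) (T-member r′ 0) , refl

    index : Fin (size single + s) → Index
    index = Fin.splitAt (size single)

    minor : OddCliqueMinor G (size single + s)
    minor = path-minor G _ (len ∘ index) (T ∘ index)
      (λ i j i′ j′ j≤ j′≤ eq → let x≡y , j≡j′ = T-injective (index i) j (index i′) j′ j≤ j′≤ eq in
        splitAt-injective (size single) x≡y , j≡j′)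
      (λ i → T-edge (index i))
      (λ i i′ i≢i′ → let j , j′ , j≤ , j′≤ , c , same = joined (index i) (index i′) in
        j , j′ , j≤ , j′≤ ,
        Close∧≢⇒adj G c (λ eq → i≢i′ (splitAt-injective (size single)
          (proj₁ (T-injective (index i) j (index i′) j′ j≤ j′≤ eq)))) , same)

  -- The offsets `suc p` and `2 + q` are chosen so that, modulo the period, the cut class of the
  -- colouring is the smallest class `p`, and the two classes in `single` are the largest
  -- consecutive pair `q`, `suc q`.
  inflation-bound : ∀ {c h} → IsChromaticNumber G c → IsOddHadwigerNumber G h → c ≤ h
  inflation-bound {c} {h} (_ , minimal) (_ , maximal) = begin
    c                                                               ≤⟨ minimal _ colours ⟩
    N q + N (suc q) + N (4 + e + suc p) + J                         ≡⟨ cong (λ t → N q + N (suc q) + t + J) shift₀ ⟩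
    N q + N (suc q) + N p + J                                       ≡⟨ ℕ.+-comm _ J ⟩
    J + (N q + N (suc q) + N p)                                     ≡⟨ ℕ.+-assoc J _ _ ⟨
    J + (N q + N (suc q)) + N p                                     ≡⟨ cong₂ (λ t u → J + (t + u) + N p) shift₁ shift₂ ⟨
    J + (N (3 + e + (2 + q)) + N (4 + e + (2 + q))) + N p           ≤⟨ ℕ.+-monoˡ-≤ (N p) M.size-single ⟩
    size M.single + N p                                             ≤⟨ maximal _ M.minor ⟩
    h                                                               ∎
    where
    open ℕ.≤-Reasoning
    J : ℕ
    J = size dominating
    N-suc-period : ∀ p → N (suc (5 + e + p)) ≡ N (suc p)
    N-suc-period p = trans (cong N (sym (ℕ.+-suc (5 + e) p))) (N-period (suc p))
    largest : ∃ λ q → ∀ p → N p + N (suc p) ≤ N q + N (suc q)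
    largest = periodic-extremum (4 + e) (λ p → N p + N (suc p))
      (λ p → cong₂ _+_ (N-period p) (N-suc-period p)) ℕ.≤-isTotalPreorder
    smallest : ∃ λ p → ∀ q → N p ≤ N q
    smallest = periodic-extremum (4 + e) N N-period (Flip.isTotalPreorder ℕ.≤-isTotalPreorder)
    q p : ℕ
    q = proj₁ largest
    p = proj₁ smallest
    colours : Colourable G (N q + N (suc q) + N (4 + e + suc p) + J)
    colours = Colouring.colourable (suc p) (N q + N (suc q)) (proj₂ largest)
    module M = Minor (2 + q) (N p) (proj₂ smallest)
    shift₀ : N (4 + e + suc p) ≡ N p
    shift₀ = trans (cong N (ℕ.+-suc (4 + e) p)) (N-period p)
    shift₁ : N (3 + e + (2 + q)) ≡ N q
    shift₁ = trans (cong N (trans (ℕ.+-suc (3 + e) (suc q)) (cong suc (ℕ.+-suc (3 + e) q)))) (N-period q)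
    shift₂ : N (4 + e + (2 + q)) ≡ N (suc q)
    shift₂ = trans (cong N (ℕ.+-suc (4 + e) (suc q))) (N-period (suc q))

-- Induced cycles as periodic sequences

module UnrolledCycle {n : ℕ} (G : Graph n) (l : ℕ) (cycle : HasInducedCycle G (suc l)) where

  private
    f : Fin (suc l) → Fin n
    f = proj₁ cycle
    f-injective : Injective _≡_ _≡_ f
    f-injective = proj₁ (proj₂ cycle)
    f-adj : ∀ i j → (adj G (f i) (f j) ≡ true → CycAdj G (suc l) i j) ×
      (CycAdj G (suc l) i j → adj G (f i) (f j) ≡ true)
    f-adj = proj₂ (proj₂ cycle)

  unroll : ℕ → Fin n
  unroll i = f (i mod suc l)

  unroll-period : ∀ i → unroll (suc l + i) ≡ unroll i
  unroll-period i = cong f (Fin.toℕ-injective (trans (Fin.toℕ-fromℕ< _)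
    (trans (trans (cong (_% suc l) (ℕ.+-comm (suc l) i)) ([m+n]%n≡m%n i (suc l))) (sym (Fin.toℕ-fromℕ< _)))))

  unroll-toℕ : ∀ x → unroll (toℕ x) ≡ f x
  unroll-toℕ x = cong f (Fin.toℕ-injective
    (trans (Fin.toℕ-fromℕ< _) (m<n⇒m%n≡m (Fin.toℕ<n x))))

  unroll-< : ∀ {i} (i< : i < suc l) → unroll i ≡ f (Fin.fromℕ< i<)
  unroll-< i< = trans (cong unroll (sym (Fin.toℕ-fromℕ< i<))) (unroll-toℕ (Fin.fromℕ< i<))

  periodic-pair : ∀ d i → close G (unroll i) (unroll (d + i)) ≡
    close G (unroll (i % suc l)) (unroll (d + i % suc l))
  periodic-pair d = periodic-% l (λ i → close G (unroll i) (unroll (d + i))) λ i →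
    cong₂ (close G) (unroll-period i)
      (trans (cong unroll (trans (ℕ.+-comm d (suc l + i)) (trans (ℕ.+-assoc (suc l) i d)
        (cong (suc l +_) (ℕ.+-comm i d))))) (unroll-period (d + i)))

  unroll-close : ∀ i → Close G (unroll i) (unroll (suc i))
  unroll-close i = trans (periodic-pair 1 i) (base (i % suc l) (m%n<n i (suc l)))
    where
    base : ∀ r → r < suc l → Close G (unroll r) (unroll (suc r))
    base r r< with ℕ.m≤n⇒m<n∨m≡n r<
    ... | inj₁ 1+r< rewrite unroll-< r< | unroll-< 1+r< = adj⇒Close G (proj₂ (f-adj _ _)
      (inj₁ (trans (cong suc (Fin.toℕ-fromℕ< r<)) (sym (Fin.toℕ-fromℕ< 1+r<)))))
    ... | inj₂ refl rewrite unroll-< r< =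
      subst (Close G (f (Fin.fromℕ< r<)))
        (trans (sym (unroll-toℕ zero)) (trans (sym (unroll-period 0)) (cong unroll (ℕ.+-identityʳ (suc l)))))
        (adj⇒Close G (proj₂ (f-adj (Fin.fromℕ< r<) zero)
          (inj₂ (inj₂ (inj₁ (cong suc (Fin.toℕ-fromℕ< r<) , refl))))))

  -- Within one turn, the only edge between non-consecutive indices is the closing one, which the
  -- last hypothesis excludes.
  unroll-far-unwrapped : ∀ i j → 2 + i ≤ j → j < suc l → ¬ (suc j ≡ suc l × i ≡ 0) →
    Far G (unroll i) (unroll j)
  unroll-far-unwrapped i j 2+i≤j j< ¬ends =
    subst₂ (Far G) (sym (unroll-< i<)) (sym (unroll-< j<)) (≢∧¬adj⇒Far G
      (λ eq → ℕ.<⇒≢ i<j (trans (sym (Fin.toℕ-fromℕ< i<))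
        (trans (cong toℕ (f-injective eq)) (Fin.toℕ-fromℕ< j<))))
      (λ uv → not-adjacent (subst₂ Adjacent (Fin.toℕ-fromℕ< i<) (Fin.toℕ-fromℕ< j<)
        (proj₁ (f-adj _ _) uv))))
    where
    i<j : i < j
    i<j = ℕ.<⇒≤ 2+i≤j
    i< : i < suc l
    i< = ℕ.<-trans i<j j<
    Adjacent : ℕ → ℕ → Set
    Adjacent i j = (suc i ≡ j) ⊎ (suc j ≡ i) ⊎ (suc i ≡ suc l × j ≡ 0) ⊎ (suc j ≡ suc l × i ≡ 0)
    not-adjacent : ¬ Adjacent i j
    not-adjacent (inj₁ eq) = ℕ.<⇒≢ 2+i≤j eq
    not-adjacent (inj₂ (inj₁ eq)) = ℕ.<-asym i<j (ℕ.≤-reflexive eq)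
    not-adjacent (inj₂ (inj₂ (inj₁ (_ , refl)))) = ℕ.n≮0 i<j
    not-adjacent (inj₂ (inj₂ (inj₂ ends))) = ¬ends ends

  -- Reduce `i` to its remainder `r`. If `2 + d + r` passes the end of the turn and lands on `t`,
  -- then `r` lies `2 + d′` after `t` with `3 + d + d′ ≡ l`, and the swapped pair lies within one
  -- turn.
  unroll-far : ∀ i j → 2 + i ≤ j → suc j ≤ l + i → Far G (unroll i) (unroll j)
  unroll-far i j 2+i≤j j< with ℕ.m≤n⇒∃[o]m+o≡n 2+i≤j
  ... | d , refl = subst (λ t → Far G (unroll i) (unroll (2 + t))) (ℕ.+-comm d i)
    (trans (periodic-pair (2 + d) i) (base (i % suc l)
      (m%n<n i (suc l))))
    where
    3+d≤l : 3 + d ≤ l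
    3+d≤l = ℕ.+-cancelʳ-≤ i (3 + d) l (subst (λ t → 3 + t ≤ l + i) (ℕ.+-comm i d) j<)
    unwrapped : ∀ d r → 3 + d ≤ l → 2 + d + r < suc l → Far G (unroll r) (unroll (2 + d + r))
    unwrapped d r 3+d≤l 2+d+r< = unroll-far-unwrapped r (2 + d + r)
      (s≤s (s≤s (ℕ.m≤n+m r d))) 2+d+r<
      (λ { (eq , refl) → ℕ.<⇒≢ 3+d≤l (trans (sym (ℕ.+-identityʳ (2 + d))) (ℕ.suc-injective eq)) })
    base : ∀ r → r < suc l → Far G (unroll r) (unroll (2 + d + r))
    base r r< with ℕ.<-≤-connex (2 + d + r) (suc l)
    ... | inj₁ 2+d+r< = unwrapped d r 3+d≤l 2+d+r<
    ... | inj₂ wraps with ℕ.m≤n⇒∃[o]m+o≡n wraps | ℕ.m≤n⇒∃[o]m+o≡n 3+d≤l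
    ... | t , 1+l+t | d′ , refl =
      subst (Far G (unroll r)) (trans (sym (unroll-period t)) (cong unroll 1+l+t))
        (Far-sym G (subst (Far G (unroll t) ∘ unroll) (sym r≡)
          (unwrapped d′ t (s≤s (s≤s (s≤s (ℕ.m≤n+m d′ d)))) (subst (_< suc l) r≡ r<))))
      where
      r≡ : r ≡ 2 + d′ + t
      r≡ = ℕ.+-cancelˡ-≡ (2 + d) r (2 + d′ + t) (trans (sym 1+l+t) (shuffle d d′ t))
        where
        shuffle : ∀ d d′ t → 4 + (d + d′) + t ≡ 2 + d + (2 + d′ + t)
        shuffle d d′ t = cong (2 +_) (trans (cong (2 +_) (ℕ.+-assoc d d′ t))
          (sym (trans (ℕ.+-suc d (suc (d′ + t))) (cong suc (ℕ.+-suc d (d′ + t))))))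

-- Excluding long cycles and combining the two cases

no-long-cycle : ∀ {n} (G : Graph n) {a} → IsIndependenceNumber G a →
  ∀ m → ¬ HasInducedCycle G (2 + m + (a + a))
-- The positions 0, 2, ..., `a + a` give `a + 1` independent vertices: the last index of the cycle
-- is at least `1 + (a + a)`, so the closing edge is not among these pairs.
no-long-cycle G {a} α m cycle = independent-bound G α (λ i → unroll (i + i)) λ i j i<j j≤a →
  let 2j≤2a = ℕ.+-mono-≤ j≤a j≤a in
  unroll-far-unwrapped (i + i) (j + j)
    (subst (_≤ j + j) (cong suc (ℕ.+-suc i i)) (ℕ.+-mono-≤ i<j i<j))
    (s≤s (ℕ.m≤n⇒m≤1+n (ℕ.≤-trans 2j≤2a (ℕ.m≤n+m (a + a) m))))
    (λ { (eq , _) → ℕ.<⇒≢ (s≤s (ℕ.≤-trans 2j≤2a (ℕ.m≤n+m (a + a) m))) (ℕ.suc-injective eq) })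
  where open UnrolledCycle G (suc m + (a + a)) cycle

theorem2p2 : (n : ℕ) (G : Graph n) (a c h : ℕ) →
    IsIndependenceNumber G a → 2 ≤ a →
    (∀ k → 4 ≤ k → k ≤ 2 * a → ¬ HasInducedCycle G k) →
    IsChromaticNumber G c → IsOddHadwigerNumber G h → c ≤ h
-- As `c ≤ h` is decidable, it may be proved by contradiction. Under its negation `non-chordal`
-- rules out cycles of length `5 + e`, so the case distinction needs no search for such a cycle.
theorem2p2 n G (suc (suc a′)) c h α (s≤s (s≤s _)) no-cycle χ oh = decidable-stable (c ℕ.≤? h) λ c≰h →
  c≰h (chordal-bound G (no-hole (λ cycle → c≰h (non-chordal cycle))) χ oh)
  where
  e : ℕ
  e = a′ + a′

  2a≡4+e : (2 + a′) + (2 + a′) ≡ 4 + e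
  2a≡4+e = cong (2 +_) (trans (ℕ.+-suc a′ (suc a′)) (cong suc (ℕ.+-suc a′ a′)))

  no-short-cycle : ∀ {m} → m ≤ e → ¬ HasInducedCycle G (4 + m)
  no-short-cycle {m} m≤e = no-cycle (4 + m) (ℕ.m≤m+n 4 m)
    (ℕ.≤-trans (ℕ.+-monoʳ-≤ 4 m≤e) (ℕ.≤-reflexive
      (trans (sym 2a≡4+e) (cong (2 + a′ +_) (sym (ℕ.+-identityʳ (2 + a′)))))))

  non-chordal : HasInducedCycle G (5 + e) → c ≤ h
  non-chordal cycle = Inflation.inflation-bound G a′ α
    (λ m≤e → no-short-cycle m≤e ∘ Hole⇒HasInducedCycle G)
    unroll unroll-period unroll-close (λ i j 2+i≤j j≤ → unroll-far i j 2+i≤j (s≤s j≤)) χ oh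
    where open UnrolledCycle G (4 + e) cycle

  no-hole : ¬ HasInducedCycle G (5 + e) → ∀ {k} → ¬ Hole G k
  no-hole no-middle-cycle hole-k@(hole {p = p} _ _ _ _) = excluded (length p) (Hole⇒HasInducedCycle G hole-k)
    where
    -- The length `4 + m` is at most 2α for `m ≤ e`, equals 2α + 1 for `m ≡ suc e`, and is at least
    -- 2α + 2 beyond that.
    excluded : ∀ m → ¬ HasInducedCycle G (4 + m)
    excluded m cycle with ℕ.<-cmp m (suc e)
    ... | tri< m≤e _ _ = no-short-cycle (ℕ.≤-pred m≤e) cycle
    ... | tri≈ _ refl _ = no-middle-cycle cycle
    ... | tri> _ _ e< with ℕ.m≤n⇒∃[o]m+o≡n e<
    ... | o , refl = no-long-cycle G α o (subst (HasInducedCycle G)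
      (trans (cong (6 +_) (ℕ.+-comm e o)) (cong (2 +_) (trans long (cong (o +_) (sym 2a≡4+e))))) cycle)
      where
      long : 4 + (o + e) ≡ o + (4 + e)
      long = trans (sym (ℕ.+-assoc 4 o e)) (trans (cong (_+ e) (ℕ.+-comm 4 o)) (ℕ.+-assoc o 4 e))
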